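{- Let $\mathcal{G}(n,m)$ denote the Erdős–Rényi random graph on $n$ vertices with exactly $m$ edges, chosen uniformly at random without replacement from the $\binom{n}{2}$ possible edges. For every constant $c=\frac{m}{n}\geq 1.073$ there is a constant $\beta>0$ such that $$\lim_{n\to\infty}\Pr\big[\mathrm{tw}(\mathcal{G}(n,m))>\beta n\big]=1 .$$
   Context: $\mathrm{tw}(G)$ denotes the treewidth of $G$: the minimum $k$ such that $G$ is a subgraph of a $k$-tree, where a $k$-tree is either a clique on $k+1$ vertices or is obtained from a $k$-tree by adding a new vertex adjacent to all vertices of a $k$-clique. The edge/vertex ratio $c=m/n$ is held fixed as $n\to\infty$ (so $m=cn$).
   Formalization: The constant c ranges over rational numbers c ≥ 1.073 only, with m read as the integer part of cn; irrational c are not covered. -}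

module Defs where

open import Data.Nat using (ℕ; zero; suc; _+_; _*_; _≤_; _<_; _<ᵇ_)
open import Data.Nat.DivMod using (_/_)
open import Data.Nat.Combinatorics using (_C_)
open import Data.Bool using (Bool; true; false; _∧_; if_then_else_)
open import Data.Fin using (Fin; zero; suc; toℕ)
open import Data.Vec using (Vec; lookup)
open import Data.List using (List; map; allFin; length)
open import Data.Nat.ListAction using (sum)
open import Data.List.Membership.Propositional using (_∈_)
open import Data.Product using (Σ; ∃; _×_)
open import Data.Empty using (⊥)
open import Function.Definitions using (Injective)
open import Relation.Binary.PropositionalEquality using (_≡_; _≢_)

Graph : ℕ → Set
Graph n = Vec (Vec Bool n) n

E : ∀ {n} → Graph n → Fin n → Fin n → Bool
E G i j = lookup (lookup G i) j

-- symmetric and loopless (so each simple graph has a unique representation)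
IsSimple : ∀ {n} → Graph n → Set
IsSimple {n} G = (∀ (i j : Fin n) → E G i j ≡ E G j i) × (∀ (i : Fin n) → E G i i ≡ false)

edgeCount : ∀ {n} → Graph n → ℕ
edgeCount {n} G =
  sum (map (λ i → sum (map (λ j → if (toℕ i <ᵇ toℕ j) ∧ E G i j then 1 else 0)
                           (allFin n)))
           (allFin n))

IsGnm : (n m : ℕ) → Graph n → Set
IsGnm n m G = IsSimple G × (edgeCount G ≡ m)

-- k-trees (vertex set Fin N), with adjacency given as a relation.
-- base: the clique on k+1 vertices; step: add a new vertex (labelled zero,
-- old vertices shifted by suc) adjacent exactly to the vertices of a k-clique.

mutual
  data KTree (k : ℕ) : ℕ → Set where
    base : KTree k (suc k)
    step : ∀ {N} (T : KTree k N) (c : Fin k → Fin N) →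
           Injective _≡_ _≡_ c →
           (∀ a b → a ≢ b → Adj T (c a) (c b)) →
           KTree k (suc N)

  Adj : ∀ {k N} → KTree k N → Fin N → Fin N → Set
  Adj base x y = x ≢ y
  Adj (step T c _ _) zero    zero    = ⊥
  Adj (step T c _ _) zero    (suc y) = ∃ λ a → c a ≡ y
  Adj (step T c _ _) (suc x) zero    = ∃ λ a → c a ≡ x
  Adj (step T c _ _) (suc x) (suc y) = Adj T x y

TwAtMost : ∀ {n} → Graph n → ℕ → Set
TwAtMost {n} G k =
  Σ ℕ λ N → Σ (KTree k N) λ T → Σ (Fin n → Fin N) λ f →
    Injective _≡_ _≡_ f × (∀ i j → E G i j ≡ true → Adj T (f i) (f j))

-- for β = p / q (q > 0):  tw(G) ≤ β n  iff  ∃ k, tw(G) ≤ k and q k ≤ p n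
TwAtMostRat : ∀ {n} → Graph n → (p q : ℕ) → Set
TwAtMostRat {n} G p q = ∃ λ k → TwAtMost G k × (q * k ≤ p * n)

-- m = ⌊ c n ⌋ for c = a / (suc b)
mOf : (a b n : ℕ) → ℕ
mOf a b n = (a * n) / suc b

{-# OPTIONS --safe #-}
-- A graph of treewidth k has a set S of at most k + 1 vertices such that every component of the rest
-- has at most n / 2 vertices.  First fit groups these components either into two parts of at most
-- 0.604 n vertices or into three parts of at most 0.396 n vertices, with no edges between parts.  So
-- a graph of treewidth at most n / 20000 has all its edges among fewer than 47/90 (two parts) or 5/14
-- (three parts) of all pairs.  Since 2 · (47/90)^(15/14) < 1 and 3 · (5/14)^(15/14) < 1, a union bound
-- over the roughly 2^n or 3^n labellings by parts suffices whenever m ≥ 15 n / 14, and 15/14 < 1.073.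
-- (Two parts alone, of sizes n/3 and 2n/3 in the worst case, would need m ≥ 1.083 n.)

module Submission where

open import Defs
open import Data.Bool using (Bool; true; false; if_then_else_; _∧_; _∨_)
open import Data.Bool.Properties using (T-≡)
open import Data.Fin using (Fin; zero; suc; _≟_; toℕ)
open import Data.Fin.Patterns using (0F; 1F; 2F)
open import Data.Fin.Properties using (all?; any?; suc-injective; toℕ-injective)
open import Data.List using (List; []; _∷_; _++_; map; length; concat; concatMap; filter; filterᵇ; tabulate; allFin; cartesianProductWith)
open import Data.List.Properties using (length-++; length-map; filter-++; map-tabulate; map-++)
open import Data.List.Membership.Propositional using (_∈_; lose)
open import Data.List.Membership.Propositional.Properties using (∈-map⁺; ∈-++⁺ˡ; ∈-++⁺ʳ; ∈-concat⁺′; ∈-concatMap⁺; ∈-tabulate⁺; ∈-filter⁺; ∈-filter⁻; ∈-cartesianProductWith⁺; ∈-allFin)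
import Data.List.Membership.DecPropositional as DecMembership
open import Data.List.Relation.Unary.Any using (here)
open import Data.Nat using (ℕ; zero; suc; _+_; _*_; _^_; _∸_; _≤_; _<_; _<ᵇ_; z≤n; s≤s; _≤?_; NonZero)
open import Data.Nat.Combinatorics using (_C_; nCk+nC[k+1]≡[n+1]C[k+1]; nC1≡n)
open import Data.Nat.DivMod using (_/_; _%_; m≡m%n+[m/n]*n; m%n<n; m/n*n≤m; /-monoˡ-≤; m*n/n≡m)
open import Data.Nat.ListAction using () renaming (sum to sumᴸ)
open import Data.Nat.ListAction.Properties using (sum-++)
open import Data.Nat.Properties hiding (_≟_; suc-injective)
open import Data.Nat.Tactic.RingSolver using (solve-∀)
open import Algebra.Properties.Semiring.Sum +-*-semiring using (sum-cong-≗; ∑-comm; ∑-distrib-+; *-distribˡ-sum; *-distribʳ-sum) renaming (sum to ∑)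
open import Data.Product using (Σ; ∃; _×_; _,_; proj₁; proj₂)
open import Data.Product.Properties using (≡-dec)
open import Data.Sum using (_⊎_; inj₁; inj₂; [_,_]′)
open import Data.Sum.Properties using (inj₁-injective)
open import Data.Unit using (⊤; tt)
open import Data.Vec using (Vec; []; _∷_; lookup) renaming (tabulate to tabulateⱽ)
open import Data.Vec.Properties using (lookup∘tabulate; tabulate∘lookup; tabulate-cong)
open import Function using (_∘_; id)
open import Function.Bundles using (Equivalence)
open import Function.Definitions using (Injective)
open import Relation.Binary.Definitions using (tri<; tri≈; tri>)
open import Relation.Binary.PropositionalEquality
open import Relation.Nullary using (¬_; Dec; yes; no; does; contradiction; _×-dec_)

-- The constant θ = 0.604 = 151/250 is squeezed from three sides. Two parts of at most θ n vertices
-- have density at worst θ² + (1 - θ)², which must stay below 2^(-14/15), so θ < 0.609. Three parts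
-- of at most (1 - θ) n vertices have density at worst 2 (1 - θ)² + (2 θ - 1)², which must stay
-- below 3^(-14/15), so θ > 0.601. First fit needs 3 θ ≥ 1 + 2 (1 - θ), that is θ ≥ 3/5. All
-- estimates are inequalities between natural numbers: a density is a pair u, v standing for u / v,
-- and the exponent 15/14 is cleared by taking 14th powers. The slack left by the strict
-- inequalities is spent on the separator, whose labels increase the number of labellings and whose
-- pairs increase the density, and on rounding.

-- Finite sums and sizes of label classes

∑-mono : ∀ {n} {f g : Fin n → ℕ} → (∀ i → f i ≤ g i) → ∑ f ≤ ∑ g
∑-mono {zero}  f≤g = z≤n
∑-mono {suc n} f≤g = +-mono-≤ (f≤g zero) (∑-mono (f≤g ∘ suc))

∑-const : ∀ n x → ∑ {n} (λ _ → x) ≡ n * x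
∑-const zero    x = refl
∑-const (suc n) x = cong (x +_) (∑-const n x)

term≤∑ : ∀ {n} (f : Fin n → ℕ) i → f i ≤ ∑ f
term≤∑ f zero    = m≤m+n _ _
term≤∑ f (suc i) = ≤-trans (term≤∑ (f ∘ suc) i) (m≤n+m _ _)

∑-zero : ∀ {n} (f : Fin n → ℕ) → (∀ i → f i ≡ 0) → ∑ f ≡ 0
∑-zero {zero}  f f≡0 = refl
∑-zero {suc n} f f≡0 = cong₂ _+_ (f≡0 zero) (∑-zero (f ∘ suc) (f≡0 ∘ suc))

𝟙 : Bool → ℕ
𝟙 b = if b then 1 else 0

δ : ∀ {q} → Fin q → Fin q → ℕ
δ a b = 𝟙 (does (a ≟ b))

δ-refl : ∀ {q} (a : Fin q) → δ a a ≡ 1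
δ-refl a with a ≟ a
... | yes _  = refl
... | no a≢a = contradiction refl a≢a

δ≤ : ∀ {q} {a b : Fin q} {x} → (a ≡ b → 1 ≤ x) → δ a b ≤ x
δ≤ {a = a} {b} h with a ≟ b
... | yes a≡b = h a≡b
... | no _    = z≤n

size : ∀ {n q} → (Fin n → Fin q) → Fin q → ℕ
size ℓ c = ∑ (λ i → δ (ℓ i) c)

-- The label zero marks the separator.
Compatible : ∀ {r} → Fin (suc r) → Fin (suc r) → Set
Compatible zero    _       = ⊤
Compatible (suc x) zero    = ⊤
Compatible (suc x) (suc y) = x ≡ y

Respects : ∀ {n r} → Graph n → (Fin n → Fin (suc r)) → Set
Respects G ℓ = ∀ i j → E G i j ≡ true → Compatible (ℓ i) (ℓ j)

∑≤1 : ∀ {n} (f : Fin n → ℕ) → (∀ i → f i ≤ 1) → (∀ i j → 1 ≤ f i → 1 ≤ f j → i ≡ j) → ∑ f ≤ 1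
∑≤1 {zero}  f f≤1 unique = z≤n
∑≤1 {suc n} f f≤1 unique with f zero in eq
... | zero = ∑≤1 (f ∘ suc) (f≤1 ∘ suc) λ i j p q → suc-injective (unique (suc i) (suc j) p q)
... | suc m = begin
    suc m + ∑ (f ∘ suc)  ≡⟨ cong (suc m +_) (∑-zero (f ∘ suc) tail≡0) ⟩
    suc m + 0            ≡⟨ +-identityʳ _ ⟩
    suc m                ≡⟨ eq ⟨
    f zero               ≤⟨ f≤1 zero ⟩
    1                    ∎
  where
  open ≤-Reasoning
  tail≡0 : ∀ i → f (suc i) ≡ 0
  tail≡0 i with f (suc i) in eq′
  ... | zero  = refl
  ... | suc _ with () ← unique zero (suc i) (subst (1 ≤_) (sym eq) (s≤s z≤n)) (subst (1 ≤_) (sym eq′) (s≤s z≤n))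

δ≤1 : ∀ {q} (a b : Fin q) → δ a b ≤ 1
δ≤1 a b = δ≤ {a = a} {b} λ _ → ≤-refl

module _ {n q N m : ℕ} {B : Set} (ℓ : Fin n → Fin q) (s : Fin q) (φ : Fin n → Fin N ⊎ B)
  (φ-injective : ∀ i j x → φ i ≡ inj₁ x → φ j ≡ inj₁ x → i ≡ j)
  (v : Fin m → Fin N) (covered : ∀ i → ℓ i ≡ s → ∃ λ a → φ i ≡ inj₁ (v a)) where

  private
    at : Fin n → Fin m → ℕ
    at i a with φ i
    ... | inj₁ x = δ x (v a)
    ... | inj₂ _ = 0

    at≤1 : ∀ i a → at i a ≤ 1
    at≤1 i a with φ i
    ... | inj₁ x = δ≤1 x (v a)
    ... | inj₂ _ = z≤n

    at-hit : ∀ i a → φ i ≡ inj₁ (v a) → 1 ≤ at i a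
    at-hit i a eq rewrite eq = ≤-reflexive (sym (δ-refl (v a)))

    at-inv : ∀ i a → 1 ≤ at i a → φ i ≡ inj₁ (v a)
    at-inv i a 1≤ with φ i
    ... | inj₁ x with x ≟ v a
    ...   | yes refl = refl
    at-inv i a () | inj₁ x | no _
    at-inv i a () | inj₂ _

  -- Double counting of the incidences between vertices labelled `s` and the `m` positions `v a`:
  -- each such vertex meets some position, and each position is met by at most one vertex since `φ`
  -- is injective there.
  size≤ : size ℓ s ≤ m
  size≤ = begin
    size ℓ s                     ≤⟨ ∑-mono (λ i → δ≤ λ eq → let a , hit = covered i eq in
                                      ≤-trans (at-hit i a hit) (term≤∑ (at i) a)) ⟩
    ∑ (λ i → ∑ (λ a → at i a))   ≡⟨ ∑-comm at ⟩
    ∑ (λ a → ∑ (λ i → at i a))   ≤⟨ ∑-mono (λ a → ∑≤1 _ (λ i → at≤1 i a) λ i j p q →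
                                      φ-injective i j (v a) (at-inv i a p) (at-inv j a q)) ⟩
    ∑ {m} (λ _ → 1)              ≡⟨ ∑-const m 1 ⟩
    m * 1                        ≡⟨ *-identityʳ m ⟩
    m                            ∎
    where open ≤-Reasoning

-- Balanced separators from k-trees

-- Scanning a k-tree from its youngest vertex, the vertices already passed fall into components
-- hanging off cliques of the remaining k-tree.  A position is either a vertex of the remaining
-- k-tree or the name of a hanging component.
Attachment : ℕ → ℕ → Set
Attachment N r = Fin r → Fin N → Bool

-- The adjacency that is left after each hanging component is contracted to a point: an edge of the
-- graph stays inside a component, runs to its attachment clique, or joins two remaining vertices.
-- Distinct components are never linked.
Linked : ∀ {k N r} → KTree k N → Attachment N r → Fin N ⊎ Fin r → Fin N ⊎ Fin r → Set
Linked T at (inj₁ x) (inj₁ y) = Adj T x y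
Linked T at (inj₁ x) (inj₂ t) = at t x ≡ true
Linked T at (inj₂ t) (inj₁ x) = at t x ≡ true
Linked T at (inj₂ s) (inj₂ t) = s ≡ t

CliqueAttachment : ∀ {k N r} → KTree k N → Attachment N r → Set
CliqueAttachment T at = ∀ t x y → at t x ≡ true → at t y ≡ true → x ≢ y → Adj T x y

label : ∀ {N r} → Fin N ⊎ Fin r → Fin (suc r)
label (inj₁ _) = zero
label (inj₂ t) = suc t

Balanced : ∀ {n r} → (Fin n → Fin (suc r)) → Set
Balanced {n} ℓ = ∀ t → 2 * size ℓ (suc t) ≤ n

inImage : ∀ {k N} → (Fin k → Fin N) → Fin N → Bool
inImage c y = does (any? (λ a → c a ≟ y))

inImage⇒∃ : ∀ {k N} (c : Fin k → Fin N) y → inImage c y ≡ true → ∃ λ a → c a ≡ y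
inImage⇒∃ c y eq with any? (λ a → c a ≟ y)
... | yes p = p

∃⇒inImage : ∀ {k N} (c : Fin k → Fin N) y → (∃ λ a → c a ≡ y) → inImage c y ≡ true
∃⇒inImage c y p with any? (λ a → c a ≟ y)
... | yes _ = refl
... | no ¬p = contradiction p ¬p

-- The youngest vertex and all components attached to it merge into one component, named `zero`.
-- Names of absorbed components survive with no vertex left, so that all old names are merely
-- shifted by one.
advance : ∀ {N r} → (Fin r → Bool) → Fin (suc N) ⊎ Fin r → Fin N ⊎ Fin (suc r)
advance at₀ (inj₁ zero)    = inj₂ zero
advance at₀ (inj₁ (suc x)) = inj₁ x
advance at₀ (inj₂ t)       = inj₂ (if at₀ t then zero else suc t)

advanceAttachment : ∀ {k N r} → (Fin k → Fin N) → Attachment (suc N) r → Attachment N (suc r)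
advanceAttachment c at zero    x = inImage c x
advanceAttachment c at (suc t) x = at t (suc x)

-- Stopping at the youngest vertex whose component is heavy: the separator consists of that vertex
-- and its older neighbours, and suc zero labels everything outside its component.
stop : ∀ {k N r} → (Fin k → Fin N) → (Fin r → Bool) → Fin (suc N) ⊎ Fin r → Fin (suc (suc r))
stop c at₀ (inj₁ zero)    = zero
stop c at₀ (inj₁ (suc x)) = if inImage c x then zero else suc zero
stop c at₀ (inj₂ t)       = suc (if at₀ t then suc t else zero)

module _ {k N r} (T : KTree k N) (c : Fin k → Fin N) (c-inj : Injective _≡_ _≡_ c)
  (c-clique : ∀ a b → a ≢ b → Adj T (c a) (c b)) (at : Attachment (suc N) r)
  (at-clique : CliqueAttachment (step T c c-inj c-clique) at) where

  private
    T⁺ = step T c c-inj c-clique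
    at₀ = λ t → at t zero

  -- The clique property is what makes the merged component hang off `c` again: if a component is
  -- attached both to the youngest vertex and to an older x, these two are adjacent, so x lies in
  -- the image of `c`.
  advance-linked : ∀ u v → Linked T⁺ at u v → Linked T (advanceAttachment c at) (advance at₀ u) (advance at₀ v)
  advance-linked (inj₁ zero) (inj₁ zero) ()
  advance-linked (inj₁ zero) (inj₁ (suc y)) h = ∃⇒inImage c y h
  advance-linked (inj₁ (suc x)) (inj₁ zero) h = ∃⇒inImage c x h
  advance-linked (inj₁ (suc x)) (inj₁ (suc y)) h = h
  advance-linked (inj₁ zero) (inj₂ t) h rewrite h = refl
  advance-linked (inj₁ (suc x)) (inj₂ t) h with at t zero in eq
  ... | true  = ∃⇒inImage c x (at-clique t zero (suc x) eq h λ ())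
  ... | false = h
  advance-linked (inj₂ t) (inj₁ zero) h rewrite h = refl
  advance-linked (inj₂ t) (inj₁ (suc x)) h with at t zero in eq
  ... | true  = ∃⇒inImage c x (at-clique t zero (suc x) eq h λ ())
  ... | false = h
  advance-linked (inj₂ s) (inj₂ .s) refl = refl

  advance-clique : CliqueAttachment T (advanceAttachment c at)
  advance-clique zero x y p q x≢y with inImage⇒∃ c x p | inImage⇒∃ c y q
  ... | a , refl | b , refl = c-clique a b λ { refl → x≢y refl }
  advance-clique (suc t) x y p q x≢y = at-clique t (suc x) (suc y) p q (x≢y ∘ suc-injective)

  stop-linked : ∀ u v → Linked T⁺ at u v → Compatible (stop c at₀ u) (stop c at₀ v)
  stop-linked (inj₁ zero) v h = tt
  stop-linked (inj₁ (suc x)) (inj₁ zero) h with inImage c x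
  ... | true  = tt
  ... | false = tt
  stop-linked (inj₁ (suc x)) (inj₁ (suc y)) h with inImage c x | inImage c y
  ... | true  | _     = tt
  ... | false | true  = tt
  ... | false | false = refl
  stop-linked (inj₁ (suc x)) (inj₂ t) h with inImage c x in eq | at t zero in eq₀
  ... | true  | _     = tt
  ... | false | false = refl
  ... | false | true  with () ← trans (sym eq) (∃⇒inImage c x (at-clique t zero (suc x) eq₀ h λ ()))
  stop-linked (inj₂ t) (inj₁ zero) h = tt
  stop-linked (inj₂ t) (inj₁ (suc x)) h with inImage c x in eq | at t zero in eq₀
  ... | true  | _     = tt
  ... | false | false = refl
  ... | false | true  with () ← trans (sym eq) (∃⇒inImage c x (at-clique t zero (suc x) eq₀ h λ ()))
  stop-linked (inj₂ s) (inj₂ .s) refl = refl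

advance-inj₁ : ∀ {N r} (at₀ : Fin r → Bool) u {x : Fin N} → advance at₀ u ≡ inj₁ x → u ≡ inj₁ (suc x)
advance-inj₁ at₀ (inj₁ (suc x)) refl = refl

closedNeighbourhood : ∀ {k N} → (Fin k → Fin N) → Fin (suc k) → Fin (suc N)
closedNeighbourhood c zero    = zero
closedNeighbourhood c (suc a) = suc (c a)

stop-zero : ∀ {k N r} (c : Fin k → Fin N) (at₀ : Fin r → Bool) u → stop c at₀ u ≡ zero →
  ∃ λ a → u ≡ inj₁ (closedNeighbourhood c a)
stop-zero c at₀ (inj₁ zero) _ = zero , refl
stop-zero c at₀ (inj₁ (suc x)) eq with inImage c x in im
... | true with b , refl ← inImage⇒∃ c x im = suc b , refl

label-zero : ∀ {N r} (u : Fin N ⊎ Fin r) → label u ≡ zero → ∃ λ x → u ≡ inj₁ x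
label-zero (inj₁ x) _ = x , refl

advance-old : ∀ {N r} (at₀ : Fin r → Bool) (u : Fin (suc N) ⊎ Fin r) t →
  δ (label (advance at₀ u)) (suc (suc t)) ≤ δ (label u) (suc t)
advance-old at₀ (inj₁ zero)    t = z≤n
advance-old at₀ (inj₁ (suc x)) t = z≤n
advance-old at₀ (inj₂ s)       t with at₀ s
... | true  = z≤n
... | false = ≤-refl

stop-old : ∀ {k N r} (c : Fin k → Fin N) (at₀ : Fin r → Bool) u t →
  δ (stop c at₀ u) (suc (suc t)) ≤ δ (label u) (suc t)
stop-old c at₀ (inj₁ zero)    t = z≤n
stop-old c at₀ (inj₁ (suc x)) t with inImage c x
... | true  = z≤n
... | false = z≤n
stop-old c at₀ (inj₂ s)       t with at₀ s
... | true  = ≤-refl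
... | false = z≤n

-- The first summand marks the outside of the merged component and the second its inside. Their
-- disjointness makes the outside light when the inside is heavy.
stop-rest : ∀ {k N r} (c : Fin k → Fin N) (at₀ : Fin r → Bool) u →
  δ (stop c at₀ u) (suc zero) + δ (label (advance at₀ u)) (suc zero) ≤ 1
stop-rest c at₀ (inj₁ zero)    = ≤-refl
stop-rest c at₀ (inj₁ (suc x)) with inImage c x
... | true  = z≤n
... | false = ≤-refl
stop-rest c at₀ (inj₂ s)       with at₀ s
... | true  = ≤-refl
... | false = ≤-refl

BalancedSeparation : ∀ {n} → Graph n → ℕ → Set
BalancedSeparation {n} G k = ∃ λ r → Σ (Fin n → Fin (suc r)) λ ℓ →
  Respects G ℓ × size ℓ zero ≤ suc k × Balanced ℓ

complement-light : ∀ m n {o} → m + n ≤ o → ¬ (2 * n ≤ o) → 2 * m ≤ o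
complement-light m n {o} m+n≤o heavy = +-cancelʳ-≤ o (2 * m) o (begin
  2 * m + o      ≤⟨ +-monoʳ-≤ (2 * m) (<⇒≤ (≰⇒> heavy)) ⟩
  2 * m + 2 * n  ≡⟨ *-distribˡ-+ 2 m n ⟨
  2 * (m + n)    ≤⟨ *-monoʳ-≤ 2 m+n≤o ⟩
  2 * o          ≡⟨ cong (o +_) (+-identityʳ o) ⟩
  o + o          ∎)
  where open ≤-Reasoning

-- Induction with the invariant that every hanging component is light. If a merger is heavy,
-- removing the youngest vertex and its k older neighbours splits the graph into components that
-- were light before and an outside that is light by complement. If no merger is ever heavy, the
-- base clique on k + 1 vertices is the separator. Sizes count vertices of `G` only, because the
-- k-tree may have many more.
scan : ∀ {k N r n} (T : KTree k N) (at : Attachment N r) → CliqueAttachment T at →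
  (G : Graph n) (φ : Fin n → Fin N ⊎ Fin r) →
  (∀ i j x → φ i ≡ inj₁ x → φ j ≡ inj₁ x → i ≡ j) →
  (∀ i j → E G i j ≡ true → Linked T at (φ i) (φ j)) →
  Balanced (label ∘ φ) → BalancedSeparation G k
scan {k} {r = r} base at at-clique G φ φ-inj linked balanced =
  r , label ∘ φ , respects , size≤ (label ∘ φ) zero φ φ-inj (λ x → x) (λ i → label-zero (φ i)) , balanced
  where
  respects : Respects G (label ∘ φ)
  respects i j eᵢⱼ with φ i | φ j | linked i j eᵢⱼ
  ... | inj₁ _ | _      | _ = tt
  ... | inj₂ _ | inj₁ _ | _ = tt
  ... | inj₂ _ | inj₂ _ | h = h
scan {k} {r = r} {n} T⁺@(step T c c-inj c-clique) at at-clique G φ φ-inj linked balanced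
  with 2 * size (label ∘ advance (λ t → at t zero) ∘ φ) (suc zero) ≤? n
... | yes light = scan T (advanceAttachment c at) (advance-clique T c c-inj c-clique at at-clique) G
  (advance at₀ ∘ φ)
  (λ i j x p q → φ-inj i j (suc x) (advance-inj₁ at₀ (φ i) p) (advance-inj₁ at₀ (φ j) q))
  (λ i j eᵢⱼ → advance-linked T c c-inj c-clique at at-clique (φ i) (φ j) (linked i j eᵢⱼ))
  balanced⁺
  where
  at₀ = λ t → at t zero
  balanced⁺ : Balanced (label ∘ advance at₀ ∘ φ)
  balanced⁺ zero    = light
  balanced⁺ (suc t) = ≤-trans (*-monoʳ-≤ 2 (∑-mono λ i → advance-old at₀ (φ i) t)) (balanced t)
... | no heavy = suc r , ℓ ,
  (λ i j eᵢⱼ → stop-linked T c c-inj c-clique at at-clique (φ i) (φ j) (linked i j eᵢⱼ)) ,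
  size≤ ℓ zero φ φ-inj (closedNeighbourhood c) (λ i → stop-zero c at₀ (φ i)) ,
  balanced-stop
  where
  at₀ = λ t → at t zero
  ℓ = stop c at₀ ∘ φ
  balanced-stop : Balanced ℓ
  balanced-stop zero = complement-light (size ℓ (suc zero)) (size (label ∘ advance at₀ ∘ φ) (suc zero)) (begin
    size ℓ (suc zero) + size (label ∘ advance at₀ ∘ φ) (suc zero)                ≡⟨ ∑-distrib-+ (λ i → δ (ℓ i) (suc zero)) _ ⟨
    ∑ (λ i → δ (ℓ i) (suc zero) + δ (label (advance at₀ (φ i))) (suc zero))      ≤⟨ ∑-mono (λ i → stop-rest c at₀ (φ i)) ⟩
    ∑ {n} (λ _ → 1)                                                              ≡⟨ ∑-const n 1 ⟩
    n * 1                                                                        ≡⟨ *-identityʳ n ⟩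
    n                                                                            ∎) heavy
    where open ≤-Reasoning
  balanced-stop (suc t) = ≤-trans (*-monoʳ-≤ 2 (∑-mono λ i → stop-old c at₀ (φ i) t)) (balanced t)

balancedSeparation : ∀ {n k} (G : Graph n) → TwAtMost G k → BalancedSeparation G k
balancedSeparation G (N , T , f , f-inj , f-adj) =
  scan {r = 0} T (λ ()) (λ ()) G (inj₁ ∘ f)
    (λ i j x p q → f-inj (inj₁-injective (trans p (sym q)))) f-adj (λ ())

-- Packing the components into two or three parts

δ-inv : ∀ {q} (a b : Fin q) → 1 ≤ δ a b → a ≡ b
δ-inv a b 1≤δ with a ≟ b
... | yes a≡b = a≡b

∑-δ-suc : ∀ {q} (a : Fin (suc q)) → ∑ (λ c → δ a (suc c)) ≤ 1
∑-δ-suc a = ∑≤1 _ (λ c → δ≤1 a (suc c)) λ c d p q →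
  suc-injective (trans (sym (δ-inv a (suc c) p)) (δ-inv a (suc d) q))

∑-δ : ∀ {q} (a : Fin q) → ∑ (δ a) ≤ 1
∑-δ a = ∑≤1 _ (δ≤1 a) λ c d p q → trans (sym (δ-inv a c p)) (δ-inv a d q)

∑-sizes : ∀ {n q} (ℓ : Fin n → Fin (suc q)) → ∑ (λ c → size ℓ (suc c)) ≤ n
∑-sizes {n} ℓ = begin
  ∑ (λ c → ∑ λ i → δ (ℓ i) (suc c))  ≡⟨ ∑-comm (λ i c → δ (ℓ i) (suc c)) ⟨
  ∑ (λ i → ∑ λ c → δ (ℓ i) (suc c))  ≤⟨ ∑-mono (λ i → ∑-δ-suc (ℓ i)) ⟩
  ∑ {n} (λ _ → 1)                    ≡⟨ ∑-const n 1 ⟩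
  n * 1                              ≡⟨ *-identityʳ n ⟩
  n                                  ∎
  where open ≤-Reasoning

load : ∀ {r q} → (Fin r → Fin q) → (Fin r → ℕ) → Fin q → ℕ
load g x c = ∑ λ j → δ (g j) c * x j

∑-load : ∀ {r q} (g : Fin r → Fin q) x → ∑ (load g x) ≤ ∑ x
∑-load g x = begin
  ∑ (λ c → ∑ λ j → δ (g j) c * x j)  ≡⟨ ∑-comm (λ j c → δ (g j) c * x j) ⟨
  ∑ (λ j → ∑ λ c → δ (g j) c * x j)  ≡⟨ sum-cong-≗ (λ j → *-distribʳ-sum (x j) (δ (g j))) ⟨
  ∑ (λ j → ∑ (δ (g j)) * x j)        ≤⟨ ∑-mono (λ j → *-monoˡ-≤ (x j) (∑-δ (g j))) ⟩
  ∑ (λ j → 1 * x j)                  ≡⟨ sum-cong-≗ (λ j → *-identityˡ (x j)) ⟩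
  ∑ x                                ∎
  where open ≤-Reasoning

regroup : ∀ {r q} → (Fin r → Fin q) → Fin (suc r) → Fin (suc q)
regroup g zero    = zero
regroup g (suc x) = suc (g x)

regroup-respects : ∀ {n r q} (G : Graph n) (ℓ : Fin n → Fin (suc r)) (g : Fin r → Fin q) →
  Respects G ℓ → Respects G (regroup g ∘ ℓ)
regroup-respects G ℓ g respects i j eᵢⱼ with ℓ i | ℓ j | respects i j eᵢⱼ
... | zero  | _     | _    = tt
... | suc _ | zero  | _    = tt
... | suc _ | suc _ | refl = refl

regroup-size-zero : ∀ {n r q} (ℓ : Fin n → Fin (suc r)) (g : Fin r → Fin q) →
  size (regroup g ∘ ℓ) zero ≡ size ℓ zero
regroup-size-zero ℓ g = sum-cong-≗ λ i → pointwise (ℓ i)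
  where
  pointwise : ∀ a → δ (regroup g a) zero ≡ δ a zero
  pointwise zero    = refl
  pointwise (suc _) = refl

regroup-size-suc : ∀ {n r q} (ℓ : Fin n → Fin (suc r)) (g : Fin r → Fin q) c →
  size (regroup g ∘ ℓ) (suc c) ≤ load g (size ℓ ∘ suc) c
regroup-size-suc ℓ g c = begin
  ∑ (λ i → δ (regroup g (ℓ i)) (suc c))                ≤⟨ ∑-mono (λ i → pointwise (ℓ i)) ⟩
  ∑ (λ i → ∑ λ j → δ (g j) c * δ (ℓ i) (suc j))        ≡⟨ ∑-comm (λ i j → δ (g j) c * δ (ℓ i) (suc j)) ⟩
  ∑ (λ j → ∑ λ i → δ (g j) c * δ (ℓ i) (suc j))        ≡⟨ sum-cong-≗ (λ j → *-distribˡ-sum (δ (g j) c) (λ i → δ (ℓ i) (suc j))) ⟨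
  load g (size ℓ ∘ suc) c                              ∎
  where
  open ≤-Reasoning
  pointwise : ∀ a → δ (regroup g a) (suc c) ≤ ∑ λ j → δ (g j) c * δ a (suc j)
  pointwise zero    = z≤n
  pointwise (suc x) = begin
    δ (g x) c                              ≡⟨ *-identityʳ _ ⟨
    δ (g x) c * 1                          ≡⟨ cong (δ (g x) c *_) (δ-refl (suc x)) ⟨
    δ (g x) c * δ (suc x) (suc x)          ≤⟨ term≤∑ (λ j → δ (g j) c * δ (suc x) (suc j)) x ⟩
    ∑ (λ j → δ (g j) c * δ (suc x) (suc j)) ∎

-- Numerals are right factors throughout, since 250 * x would unfold to a sum of 250 terms.
Window : ∀ {r} → ℕ → (Fin r → ℕ) → Set
Window {r} n x = Σ (Fin r → Fin 2) λ g → n * 99 ≤ load g x 0F * 250 × load g x 0F * 250 ≤ n * 151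

ThreeBins : ∀ {r} → ℕ → (Fin r → ℕ) → Set
ThreeBins {r} n x = Σ (Fin r → Fin 3) λ g → ∀ c → load g x c * 250 ≤ n * 99

extend : ∀ {r} {A : Set} → A → (Fin r → A) → Fin (suc r) → A
extend a g zero    = a
extend a g (suc j) = g j

-- The three sums x + lᵢ add up to the total and two further copies of x, hence to at most 250 + 2 ·
-- 99 = 448 units of n / 250, whereas three overshoots exceed 3 · 151 = 453 units.
overfull : ∀ n x l₀ l₁ l₂ → x * 250 ≤ n * 99 → x + (l₀ + (l₁ + (l₂ + 0))) ≤ n →
  n * 151 < (x + l₀) * 250 → n * 151 < (x + l₁) * 250 → ¬ (n * 151 < (x + l₂) * 250)
overfull n x l₀ l₁ l₂ small total h₀ h₁ h₂ = <⇒≱ (+-mono-< (+-mono-< h₀ h₁) h₂) (begin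
  (x + l₀) * 250 + (x + l₁) * 250 + (x + l₂) * 250        ≡⟨ cong (_+ (x + l₂) * 250) (*-distribʳ-+ 250 (x + l₀) (x + l₁)) ⟨
  (x + l₀ + (x + l₁)) * 250 + (x + l₂) * 250              ≡⟨ *-distribʳ-+ 250 (x + l₀ + (x + l₁)) (x + l₂) ⟨
  (x + l₀ + (x + l₁) + (x + l₂)) * 250                    ≡⟨ cong (_* 250) (rearrange x l₀ l₁ l₂) ⟩
  (x + x + (x + (l₀ + (l₁ + (l₂ + 0))))) * 250            ≡⟨ *-distribʳ-+ 250 (x + x) _ ⟩
  (x + x) * 250 + (x + (l₀ + (l₁ + (l₂ + 0)))) * 250      ≡⟨ cong (_+ (x + (l₀ + (l₁ + (l₂ + 0)))) * 250) (*-distribʳ-+ 250 x x) ⟩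
  x * 250 + x * 250 + (x + (l₀ + (l₁ + (l₂ + 0)))) * 250  ≤⟨ +-mono-≤ (+-mono-≤ small small) (*-monoˡ-≤ 250 total) ⟩
  n * 99 + n * 99 + n * 250                               ≡⟨ cong (_+ n * 250) (*-distribˡ-+ n 99 99) ⟨
  n * 198 + n * 250                                       ≡⟨ *-distribˡ-+ n 198 250 ⟨
  n * 448                                                 ≤⟨ *-monoʳ-≤ n (m≤m+n 448 5) ⟩
  n * 453                                                 ≡⟨ *-distribˡ-+ n 302 151 ⟩
  n * 302 + n * 151                                       ≡⟨ cong (_+ n * 151) (*-distribˡ-+ n 151 151) ⟩
  n * 151 + n * 151 + n * 151                             ∎)
  where
  open ≤-Reasoning
  rearrange : ∀ x l₀ l₁ l₂ → x + l₀ + (x + l₁) + (x + l₂) ≡ x + x + (x + (l₀ + (l₁ + (l₂ + 0))))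
  rearrange = solve-∀

side : Bool → Fin 2
side b = if b then 0F else 1F

∑-indicator : ∀ {r q} (g : Fin r → Fin q) (x : Fin r → ℕ) c →
  load (λ j → side (does (g j ≟ c))) x 0F ≡ load g x c
∑-indicator g x c = sum-cong-≗ λ j → cong (_* x j) (pointwise (g j))
  where
  pointwise : ∀ a → δ (side (does (a ≟ c))) 0F ≡ δ a c
  pointwise a with does (a ≟ c)
  ... | true  = refl
  ... | false = refl

-- First fit: an item fitting into none of the three bins overshoots 151n/250 with each of them,
-- unless it completes one of them to a set in the window; overshooting thrice exceeds the total n.
firstFit : ∀ {r} n (x : Fin r → ℕ) → (∀ j → 2 * x j ≤ n) → ∑ x ≤ n → Window n x ⊎ ThreeBins n x
firstFit {zero}  n x half total = inj₂ ((λ ()) , λ c → z≤n)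
firstFit {suc r} n x half total
  with firstFit n (x ∘ suc) (half ∘ suc) (≤-trans (m≤n+m _ (x zero)) total)
... | inj₁ (g , lo , hi) = inj₁ (extend 1F g , lo , hi)
... | inj₂ (g , fits) with x zero * 250 ≤? n * 99
-- A big item is in the window by itself: its upper bound n / 2 is 125n/250.
...   | no big = inj₁ (extend 0F (λ _ → 1F) , subst (λ l → n * 99 ≤ l * 250) (sym alone) (<⇒≤ (≰⇒> big)) ,
                       subst (λ l → l * 250 ≤ n * 151) (sym alone) (begin
    x zero * 250        ≡⟨ trans (sym (*-assoc (x zero) 2 125)) (cong (_* 125) (*-comm (x zero) 2)) ⟩
    (2 * x zero) * 125  ≤⟨ *-monoˡ-≤ 125 (half zero) ⟩
    n * 125             ≤⟨ *-monoʳ-≤ n (m≤m+n 125 26) ⟩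
    n * 151             ∎))
  where
  open ≤-Reasoning
  alone : load (extend {r} 0F (λ _ → side false)) x 0F ≡ x zero
  alone = trans (cong (1 * x zero +_) (∑-zero {r} (λ j → 0) λ _ → refl)) (trans (+-identityʳ _) (*-identityˡ (x zero)))
...   | yes small = decide (try 0F) (try 1F) (try 2F)
  where
  old : Fin 3 → ℕ
  old = load g (x ∘ suc)
  Overshoot : Fin 3 → Set
  Overshoot c = n * 151 < (x zero + old c) * 250

  put : ∀ c → (x zero + old c) * 250 ≤ n * 99 → ThreeBins n x
  put c fit = extend c g , λ d → fits′ d
    where
    fits′ : ∀ d → (δ c d * x zero + old d) * 250 ≤ n * 99
    fits′ d with c ≟ d
    ... | yes refl = subst (λ y → (y + old c) * 250 ≤ n * 99) (sym (*-identityˡ (x zero))) fit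
    ... | no _     = fits d

  try : ∀ c → (Window n x ⊎ ThreeBins n x) ⊎ Overshoot c
  try c with (x zero + old c) * 250 ≤? n * 99
  ... | yes fit = inj₁ (inj₂ (put c fit))
  ... | no ¬fit with (x zero + old c) * 250 ≤? n * 151
  ...   | no ¬hi = inj₂ (≰⇒> ¬hi)
  ...   | yes hi = inj₁ (inj₁ (extend 0F (λ j → side (does (g j ≟ c))) ,
            subst (λ l → n * 99 ≤ l * 250) (sym merged) (<⇒≤ (≰⇒> ¬fit)) ,
            subst (λ l → l * 250 ≤ n * 151) (sym merged) hi))
    where
    merged : 1 * x zero + load (λ j → side (does (g j ≟ c))) (x ∘ suc) 0F ≡ x zero + old c
    merged = cong₂ _+_ (*-identityˡ (x zero)) (∑-indicator g (x ∘ suc) c)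

  decide : (Window n x ⊎ ThreeBins n x) ⊎ Overshoot 0F → (Window n x ⊎ ThreeBins n x) ⊎ Overshoot 1F →
    (Window n x ⊎ ThreeBins n x) ⊎ Overshoot 2F → Window n x ⊎ ThreeBins n x
  decide (inj₁ r)  _         _         = r
  decide (inj₂ _)  (inj₁ r)  _         = r
  decide (inj₂ _)  (inj₂ _)  (inj₁ r)  = r
  decide (inj₂ h₀) (inj₂ h₁) (inj₂ h₂) = contradiction h₂
    (overfull n (x zero) (old 0F) (old 1F) (old 2F) small
      (≤-trans (+-monoʳ-≤ (x zero) (∑-load g (x ∘ suc))) total) h₀ h₁)

Good : ∀ {n r} → ℕ → (Fin n → Fin (suc r)) → Set
Good {n} θ ℓ = size ℓ zero * 10000 ≤ n × (∀ c → size ℓ (suc c) * 250 ≤ n * θ)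

GoodLabelling : ∀ {n} → Graph n → (r θ : ℕ) → Set
GoodLabelling {n} G r θ = Σ (Fin n → Fin (suc r)) λ ℓ → Respects G ℓ × Good θ ℓ

goodLabelling : ∀ {n k} (G : Graph n) → TwAtMost G k → suc k * 10000 ≤ n →
  GoodLabelling G 2 151 ⊎ GoodLabelling G 3 99
goodLabelling {n} {k} G tw k-small
  with r , ℓ , respects , sep , balanced ← balancedSeparation G tw
  with firstFit n (size ℓ ∘ suc) balanced (∑-sizes ℓ)
... | inj₂ (g , fits) = inj₂ (regroup g ∘ ℓ , regroup-respects G ℓ g respects ,
    subst (λ s → s * 10000 ≤ n) (sym (regroup-size-zero ℓ g)) (≤-trans (*-monoˡ-≤ 10000 sep) k-small) ,
    λ c → ≤-trans (*-monoˡ-≤ 250 (regroup-size-suc ℓ g c)) (fits c))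
... | inj₁ (g , lo , hi) = inj₁ (regroup g ∘ ℓ , regroup-respects G ℓ g respects ,
    subst (λ s → s * 10000 ≤ n) (sym (regroup-size-zero ℓ g)) (≤-trans (*-monoˡ-≤ 10000 sep) k-small) ,
    λ c → ≤-trans (*-monoˡ-≤ 250 (regroup-size-suc ℓ g c)) (fits c))
  where
  open ≤-Reasoning
  l₀ = load g (size ℓ ∘ suc) 0F
  l₁ = load g (size ℓ ∘ suc) 1F
  fits : ∀ c → load g (size ℓ ∘ suc) c * 250 ≤ n * 151
  fits 0F = hi
  -- The lower end of the window caps the second part, as 250 - 99 = 151.
  fits 1F = +-cancelˡ-≤ (n * 99) (l₁ * 250) (n * 151) (begin
    n * 99 + l₁ * 250         ≤⟨ +-monoˡ-≤ (l₁ * 250) lo ⟩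
    l₀ * 250 + l₁ * 250       ≡⟨ *-distribʳ-+ 250 l₀ l₁ ⟨
    (l₀ + l₁) * 250           ≡⟨ cong (λ l → (l₀ + l) * 250) (+-identityʳ l₁) ⟨
    (l₀ + (l₁ + 0)) * 250     ≤⟨ *-monoˡ-≤ 250 (≤-trans (∑-load g (size ℓ ∘ suc)) (∑-sizes ℓ)) ⟩
    n * 250                   ≡⟨ *-distribˡ-+ n 99 151 ⟩
    n * 99 + n * 151          ∎)

-- Sums of squares under a cap

-- Convexity: the extremal pair is (a, b). When both numbers exceed b, the surplus y - b fits into
-- the room a - x, and moving it from y to x does not lower the sum because x ≥ b.
squares₂ : ∀ a b x y → x ≤ a → y ≤ a → x + y ≤ a + b → x * x + y * y ≤ a * a + b * b
squares₂ a b x y x≤a y≤a x+y≤a+b with x ≤? b | y ≤? b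
... | yes x≤b | _ = ≤-trans (+-mono-≤ (*-mono-≤ x≤b x≤b) (*-mono-≤ y≤a y≤a)) (≤-reflexive (+-comm (b * b) (a * a)))
... | no _ | yes y≤b = +-mono-≤ (*-mono-≤ x≤a x≤a) (*-mono-≤ y≤b y≤b)
... | no x≰b | no y≰b = subst₂ (λ a y → x * x + y * y ≤ a * a + b * b) (m+[n∸m]≡n x≤a) (m+[n∸m]≡n b≤y) (begin
    x * x + (b + v) * (b + v)                  ≡⟨ expandˡ x b v ⟩
    x * x + b * b + 2 * (b * v) + v * v        ≤⟨ +-mono-≤ (+-monoʳ-≤ (x * x + b * b) (*-monoʳ-≤ 2 (*-mono-≤ b≤x v≤u))) (*-mono-≤ v≤u v≤u) ⟩
    x * x + b * b + 2 * (x * u) + u * u        ≡⟨ expandʳ x b u ⟩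
    (x + u) * (x + u) + b * b                  ∎)
  where
  open ≤-Reasoning
  b≤x = <⇒≤ (≰⇒> x≰b)
  b≤y = <⇒≤ (≰⇒> y≰b)
  u = a ∸ x
  v = y ∸ b
  expandˡ : ∀ x b v → x * x + (b + v) * (b + v) ≡ x * x + b * b + 2 * (b * v) + v * v
  expandˡ = solve-∀
  expandʳ : ∀ x b u → x * x + b * b + 2 * (x * u) + u * u ≡ (x + u) * (x + u) + b * b
  expandʳ = solve-∀
  shuffle : ∀ x b v → x + b + v ≡ x + (b + v)
  shuffle = solve-∀
  shuffle′ : ∀ x b u → x + u + b ≡ x + b + u
  shuffle′ = solve-∀
  v≤u : v ≤ u
  v≤u = +-cancelˡ-≤ (x + b) v u (begin
    x + b + v    ≡⟨ shuffle x b v ⟩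
    x + (b + v)  ≡⟨ cong (x +_) (m+[n∸m]≡n b≤y) ⟩
    x + y        ≤⟨ x+y≤a+b ⟩
    a + b        ≡⟨ cong (_+ b) (m+[n∸m]≡n x≤a) ⟨
    x + u + b    ≡⟨ shuffle′ x b u ⟩
    x + b + u    ∎)

-- Two transfers: x and y are replaced by a and the remainder w, then w and z by a and b.
squares₃ : ∀ a b x y z → x ≤ a → y ≤ a → z ≤ a → x + (y + z) ≤ a + (a + b) →
  x * x + (y * y + z * z) ≤ a * a + (a * a + b * b)
squares₃ a b x y z x≤a y≤a z≤a total = begin
  x * x + (y * y + z * z)  ≡⟨ +-assoc (x * x) (y * y) (z * z) ⟨
  x * x + y * y + z * z    ≤⟨ +-monoˡ-≤ (z * z) (squares₂ a w x y x≤a y≤a (m≤n+m∸n (x + y) a)) ⟩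
  a * a + w * w + z * z    ≡⟨ +-assoc (a * a) (w * w) (z * z) ⟩
  a * a + (w * w + z * z)  ≤⟨ +-monoʳ-≤ (a * a) (squares₂ a b w z w≤a z≤a w+z≤a+b) ⟩
  a * a + (a * a + b * b)  ∎
  where
  open ≤-Reasoning
  w = (x + y) ∸ a
  w≤a : w ≤ a
  w≤a = m≤n+o⇒m∸n≤o (x + y) a (+-mono-≤ x≤a y≤a)
  w+z≤a+b : w + z ≤ a + b
  w+z≤a+b with x + y ≤? a
  -- Truncated subtraction gives `w` = 0 here, so the cap on z is enough.
  ... | yes x+y≤a rewrite m≤n⇒m∸n≡0 x+y≤a = ≤-trans z≤a (m≤m+n a b)
  ... | no x+y≰a = +-cancelˡ-≤ a (w + z) (a + b) (begin
    a + (w + z)    ≡⟨ +-assoc a w z ⟨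
    a + w + z      ≡⟨ cong (_+ z) (m+[n∸m]≡n (<⇒≤ (≰⇒> x+y≰a))) ⟩
    x + y + z      ≡⟨ +-assoc x y z ⟩
    x + (y + z)    ≤⟨ total ⟩
    a + (a + b)    ∎)

-- Pairs allowed by a labelling

allowed : ∀ {r} → Fin (suc r) → Fin (suc r) → Bool
allowed zero    _       = true
allowed (suc _) zero    = true
allowed (suc x) (suc y) = does (x ≟ y)

compatible⇒allowed : ∀ {r} (a b : Fin (suc r)) → Compatible a b → allowed a b ≡ true
compatible⇒allowed zero    b       _ = refl
compatible⇒allowed (suc x) zero    _ = refl
compatible⇒allowed (suc x) (suc y) x≡y with x ≟ y
... | yes _  = refl
... | no x≢y = contradiction x≡y x≢y

allowed-sym : ∀ {r} (a b : Fin (suc r)) → allowed a b ≡ allowed b a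
allowed-sym zero    zero    = refl
allowed-sym zero    (suc y) = refl
allowed-sym (suc x) zero    = refl
allowed-sym (suc x) (suc y) with x ≟ y | y ≟ x
... | yes _    | yes _    = refl
... | no _     | no _     = refl
... | yes refl | no y≢x   = contradiction refl y≢x
... | no x≢y   | yes refl = contradiction refl x≢y

-- Each term on the right is a product of a function of `a` and a function of `b`, so its sum over
-- all ordered pairs depends on the class sizes alone. Pairs inside the separator are counted twice.
allowed≤ : ∀ {r} (a b : Fin (suc r)) →
  𝟙 (allowed a b) ≤ δ a zero + δ b zero + ∑ λ c → δ a (suc c) * δ b (suc c)
allowed≤ zero    b       = s≤s z≤n
allowed≤ (suc x) zero    = s≤s z≤n
allowed≤ (suc x) (suc y) = δ≤ {a = x} {y} λ { refl → begin
  1 * 1                                        ≡⟨ cong₂ _*_ (δ-refl x) (δ-refl x) ⟨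
  δ (suc x) (suc x) * δ (suc x) (suc x)        ≤⟨ term≤∑ (λ c → δ (suc x) (suc c) * δ (suc x) (suc c)) x ⟩
  (∑ λ c → δ (suc x) (suc c) * δ (suc x) (suc c)) ∎ }
  where open ≤-Reasoning

length-filter-concat-tabulate : ∀ {A : Set} {k} (p : A → Bool) (F : Fin k → List A) →
  length (filterᵇ p (concat (tabulate F))) ≡ ∑ λ i → length (filterᵇ p (F i))
length-filter-concat-tabulate {k = zero}  p F = refl
length-filter-concat-tabulate {k = suc k} p F = trans
  (cong length (filter-++ _ (F zero) _))
  (trans (length-++ (filterᵇ p (F zero)))
    (cong (length (filterᵇ p (F zero)) +_) (length-filter-concat-tabulate p (F ∘ suc))))

length-filter-tabulate : ∀ {A : Set} {k} (p : A → Bool) (f : Fin k → A) →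
  length (filterᵇ p (tabulate f)) ≡ ∑ λ i → 𝟙 (p (f i))
length-filter-tabulate {k = zero}  p f = refl
length-filter-tabulate {k = suc k} p f with p (f zero)
... | true  = cong suc (length-filter-tabulate p (f ∘ suc))
... | false = length-filter-tabulate p (f ∘ suc)

module _ {n : ℕ} where

  _<ᶠ_ : Fin n → Fin n → Bool
  i <ᶠ j = toℕ i <ᵇ toℕ j

  <ᶠ-asym : ∀ i j → i <ᶠ j ≡ true → j <ᶠ i ≡ true → ∀ {A : Set} → A
  <ᶠ-asym i j p q = contradiction (<ᵇ⇒< (toℕ j) (toℕ i) (Equivalence.from T-≡ q)) (<-asym (<ᵇ⇒< (toℕ i) (toℕ j) (Equivalence.from T-≡ p)))

  -- An unordered pair gives two ordered ones; the slack is the diagonal.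
  half-symmetric : (h : Fin n → Fin n → Bool) → (∀ i j → h i j ≡ h j i) →
    2 * ∑ (λ i → ∑ λ j → 𝟙 ((i <ᶠ j) ∧ h i j)) ≤ ∑ (λ i → ∑ λ j → 𝟙 (h i j))
  half-symmetric h h-sym = begin
    2 * ∑ (λ i → ∑ (upper i))                              ≡⟨ cong (∑ (λ i → ∑ (upper i)) +_) (+-identityʳ _) ⟩
    ∑ (λ i → ∑ (upper i)) + ∑ (λ i → ∑ (upper i))          ≡⟨ cong (∑ (λ i → ∑ (upper i)) +_) (∑-comm upper) ⟩
    ∑ (λ i → ∑ (upper i)) + ∑ (λ i → ∑ λ j → upper j i)    ≡⟨ ∑-distrib-+ (λ i → ∑ (upper i)) _ ⟨
    ∑ (λ i → ∑ (upper i) + ∑ λ j → upper j i)              ≡⟨ sum-cong-≗ (λ i → ∑-distrib-+ (upper i) (λ j → upper j i)) ⟨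
    ∑ (λ i → ∑ λ j → upper i j + upper j i)                ≤⟨ ∑-mono (λ i → ∑-mono (pointwise i)) ⟩
    ∑ (λ i → ∑ λ j → 𝟙 (h i j))                            ∎
    where
    open ≤-Reasoning
    upper : Fin n → Fin n → ℕ
    upper i j = 𝟙 ((i <ᶠ j) ∧ h i j)
    pointwise : ∀ i j → upper i j + upper j i ≤ 𝟙 (h i j)
    pointwise i j with i <ᶠ j in i<j | j <ᶠ i in j<i
    ... | true  | true  = <ᶠ-asym i j i<j j<i
    ... | true  | false = ≤-reflexive (+-identityʳ _)
    ... | false | true  = ≤-reflexive (cong 𝟙 (h-sym j i))
    ... | false | false = z≤n

  ∑-allowed : ∀ {r} (ℓ : Fin n → Fin (suc r)) →
    ∑ (λ i → ∑ λ j → 𝟙 (allowed (ℓ i) (ℓ j))) ≤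
    size ℓ zero * n + n * size ℓ zero + ∑ λ c → size ℓ (suc c) * size ℓ (suc c)
  ∑-allowed ℓ = begin
    ∑ (λ i → ∑ λ j → 𝟙 (allowed (ℓ i) (ℓ j)))
      ≤⟨ ∑-mono (λ i → ∑-mono λ j → allowed≤ (ℓ i) (ℓ j)) ⟩
    ∑ (λ i → ∑ λ j → s i + s j + ∑ λ c → p c i * p c j)
      ≡⟨ sum-cong-≗ (λ i → trans (∑-distrib-+ (λ j → s i + s j) _) (cong₂ _+_
           (trans (∑-distrib-+ (λ _ → s i) s) (cong (_+ ∑ s) (trans (∑-const n (s i)) (*-comm n (s i)))))
           (trans (∑-comm (λ j c → p c i * p c j)) (sum-cong-≗ λ c → sym (*-distribˡ-sum (p c i) (p c)))))) ⟩
    ∑ (λ i → s i * n + ∑ s + ∑ λ c → p c i * ∑ (p c))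
      ≡⟨ trans (∑-distrib-+ (λ i → s i * n + ∑ s) _) (cong₂ _+_
           (trans (∑-distrib-+ (λ i → s i * n) _) (cong₂ _+_ (sym (*-distribʳ-sum n s)) (∑-const n (∑ s))))
           (trans (∑-comm (λ i c → p c i * ∑ (p c))) (sum-cong-≗ λ c → sym (*-distribʳ-sum (∑ (p c)) (p c))))) ⟩
    ∑ s * n + n * ∑ s + ∑ (λ c → ∑ (p c) * ∑ (p c)) ∎
    where
    open ≤-Reasoning
    s = λ i → δ (ℓ i) zero
    p = λ c i → δ (ℓ i) (suc c)

  allPairs : List (Fin n × Fin n)
  allPairs = concat (tabulate λ i → tabulate λ j → i , j)

  ∈-allPairs : ∀ i j → (i , j) ∈ allPairs
  ∈-allPairs i j = ∈-concat⁺′ (∈-tabulate⁺ {f = λ j → i , j} j) (∈-tabulate⁺ {f = λ i → tabulate λ j → i , j} i)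

  length-filter-allPairs : ∀ p → length (filterᵇ p allPairs) ≡ ∑ λ i → ∑ λ j → 𝟙 (p (i , j))
  length-filter-allPairs p = trans (length-filter-concat-tabulate p (λ i → tabulate λ j → i , j))
    (sum-cong-≗ λ i → length-filter-tabulate p (λ j → i , j))

  sum-map-allFin : (f : Fin n → ℕ) → sumᴸ (map f (allFin n)) ≡ ∑ f
  sum-map-allFin f = trans (cong sumᴸ (map-tabulate id f)) (sum-tabulate f)
    where
    sum-tabulate : ∀ {k} (f : Fin k → ℕ) → sumᴸ (tabulate f) ≡ ∑ f
    sum-tabulate {zero}  f = refl
    sum-tabulate {suc k} f = cong (f zero +_) (sum-tabulate (f ∘ suc))

  edgeCount-∑ : (G : Graph n) → edgeCount G ≡ ∑ λ i → ∑ λ j → 𝟙 ((i <ᶠ j) ∧ E G i j)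
  edgeCount-∑ G = trans (sum-map-allFin λ i → sumᴸ (map (λ j → 𝟙 ((i <ᶠ j) ∧ E G i j)) (allFin n)))
    (sum-cong-≗ λ i → sum-map-allFin λ j → 𝟙 ((i <ᶠ j) ∧ E G i j))

-- Enumerating the graphs that respect a labelling

filter-filter : ∀ {A : Set} (p q : A → Bool) xs → filterᵇ q (filterᵇ p xs) ≡ filterᵇ (λ x → p x ∧ q x) xs
filter-filter p q [] = refl
filter-filter p q (x ∷ xs) with p x
... | false = filter-filter p q xs
... | true with q x
...   | true  = cong (x ∷_) (filter-filter p q xs)
...   | false = filter-filter p q xs

-- Order is kept, so every choice of m positions occurs once and the recursion is Pascal's rule.
sublists : ∀ {A : Set} → ℕ → List A → List (List A)
sublists zero    xs       = [] ∷ []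
sublists (suc m) []       = []
sublists (suc m) (x ∷ xs) = map (x ∷_) (sublists m xs) ++ sublists (suc m) xs

length-sublists : ∀ {A : Set} m (xs : List A) → length (sublists m xs) ≡ length xs C m
length-sublists zero    xs       = refl
length-sublists (suc m) []       = refl
length-sublists (suc m) (x ∷ xs) = begin
  length (map (x ∷_) (sublists m xs) ++ sublists (suc m) xs)        ≡⟨ length-++ (map (x ∷_) (sublists m xs)) ⟩
  length (map (x ∷_) (sublists m xs)) + length (sublists (suc m) xs) ≡⟨ cong₂ _+_ (trans (length-map _ (sublists m xs)) (length-sublists m xs)) (length-sublists (suc m) xs) ⟩
  length xs C m + length xs C suc m                                  ≡⟨ nCk+nC[k+1]≡[n+1]C[k+1] (length xs) m ⟩
  suc (length xs) C suc m                                            ∎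
  where open ≡-Reasoning

filter∈sublists : ∀ {A : Set} (p : A → Bool) xs m → length (filterᵇ p xs) ≡ m → filterᵇ p xs ∈ sublists m xs
filter∈sublists p []       zero    _ = here refl
filter∈sublists p (x ∷ xs) m eq with p x
filter∈sublists p (x ∷ xs) (suc m) eq | true  = ∈-++⁺ˡ (∈-map⁺ (x ∷_) (filter∈sublists p xs m (cong (_∸ 1) eq)))
filter∈sublists p (x ∷ xs) (suc m) eq | false = ∈-++⁺ʳ (map (x ∷_) (sublists m xs)) (filter∈sublists p xs (suc m) eq)
filter∈sublists p (x ∷ xs) zero    eq | false with filterᵇ p xs
... | [] = here refl

module _ {n : ℕ} where
  open DecMembership (≡-dec (_≟_ {n}) (_≟_ {n})) using (_∈?_)

  fromEdges : List (Fin n × Fin n) → Graph n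
  fromEdges es = tabulateⱽ λ i → tabulateⱽ λ j → does ((i , j) ∈? es) ∨ does ((j , i) ∈? es)

  fromEdges≡ : (es : List (Fin n × Fin n)) (G : Graph n) → (∀ i j → E G i j ≡ E G j i) →
    (∀ i j → (i , j) ∈ es → E G i j ≡ true) →
    (∀ i j → E G i j ≡ true → (i , j) ∈ es ⊎ (j , i) ∈ es) → fromEdges es ≡ G
  fromEdges≡ es G G-sym sound complete = trans
    (tabulate-cong λ i → trans (tabulate-cong (entry i)) (tabulate∘lookup (lookup G i)))
    (tabulate∘lookup G)
    where
    entry : ∀ i j → does ((i , j) ∈? es) ∨ does ((j , i) ∈? es) ≡ E G i j
    entry i j with (i , j) ∈? es | (j , i) ∈? es
    ... | yes p | _     = sym (sound i j p)
    ... | no _  | yes q = sym (trans (G-sym i j) (sound j i q))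
    ... | no ¬p | no ¬q with E G i j in eq
    ...   | false = refl
    ...   | true with complete i j eq
    ...     | inj₁ p = contradiction p ¬p
    ...     | inj₂ q = contradiction q ¬q

  allowedPairs : ∀ {r} → (Fin n → Fin (suc r)) → List (Fin n × Fin n)
  allowedPairs ℓ = filterᵇ (λ (i , j) → (i <ᶠ j) ∧ allowed (ℓ i) (ℓ j)) allPairs

  graphs : ∀ {r} → ℕ → (Fin n → Fin (suc r)) → List (Graph n)
  graphs m ℓ = map fromEdges (sublists m (allowedPairs ℓ))

  length-graphs : ∀ {r} m (ℓ : Fin n → Fin (suc r)) → length (graphs m ℓ) ≡ length (allowedPairs ℓ) C m
  length-graphs m ℓ = trans (length-map fromEdges (sublists m (allowedPairs ℓ))) (length-sublists m (allowedPairs ℓ))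

  2*length-allowedPairs : ∀ {r} (ℓ : Fin n → Fin (suc r)) → 2 * length (allowedPairs ℓ) ≤
    size ℓ zero * n + n * size ℓ zero + ∑ λ c → size ℓ (suc c) * size ℓ (suc c)
  2*length-allowedPairs ℓ = begin
    2 * length (allowedPairs ℓ)                                ≡⟨ cong (2 *_) (length-filter-allPairs λ (i , j) → (i <ᶠ j) ∧ allowed (ℓ i) (ℓ j)) ⟩
    2 * ∑ (λ i → ∑ λ j → 𝟙 ((i <ᶠ j) ∧ allowed (ℓ i) (ℓ j)))   ≤⟨ half-symmetric (λ i j → allowed (ℓ i) (ℓ j)) (λ i j → allowed-sym (ℓ i) (ℓ j)) ⟩
    ∑ (λ i → ∑ λ j → 𝟙 (allowed (ℓ i) (ℓ j)))                  ≤⟨ ∑-allowed ℓ ⟩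
    size ℓ zero * n + n * size ℓ zero + (∑ λ c → size ℓ (suc c) * size ℓ (suc c)) ∎
    where open ≤-Reasoning

  -- Every edge of `G`, written with its smaller end first, is an allowed pair. Filtering the
  -- allowed pairs by adjacency therefore loses no edge and yields a sublist of length m, from which
  -- `fromEdges` rebuilds `G`.
  ∈-graphs : ∀ {r} m (ℓ : Fin n → Fin (suc r)) (G : Graph n) → IsGnm n m G → Respects G ℓ → G ∈ graphs m ℓ
  ∈-graphs m ℓ G ((G-sym , loopless) , count) respects =
    subst (_∈ graphs m ℓ) (fromEdges≡ edges G G-sym sound complete)
      (∈-map⁺ fromEdges (filter∈sublists isEdge (allowedPairs ℓ) m length-edges))
    where
    isEdge : Fin n × Fin n → Bool
    isEdge (i , j) = E G i j
    edges = filterᵇ isEdge (allowedPairs ℓ)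

    E⇒allowed : ∀ i j → E G i j ≡ true → allowed (ℓ i) (ℓ j) ≡ true
    E⇒allowed i j eᵢⱼ = compatible⇒allowed (ℓ i) (ℓ j) (respects i j eᵢⱼ)

    absorb : ∀ b i j → (b ∧ allowed (ℓ i) (ℓ j)) ∧ E G i j ≡ b ∧ E G i j
    absorb false i j = refl
    absorb true  i j with E G i j in eq
    ... | true rewrite E⇒allowed i j eq = refl
    ... | false with allowed (ℓ i) (ℓ j)
    ...   | true  = refl
    ...   | false = refl

    length-edges : length edges ≡ m
    length-edges = begin
      length edges                                       ≡⟨ cong length (filter-filter _ isEdge allPairs) ⟩
      length (filterᵇ (λ (i , j) → ((i <ᶠ j) ∧ allowed (ℓ i) (ℓ j)) ∧ E G i j) allPairs) ≡⟨ length-filter-allPairs {n} (λ (i , j) → ((i <ᶠ j) ∧ allowed (ℓ i) (ℓ j)) ∧ E G i j) ⟩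
      ∑ (λ i → ∑ λ j → 𝟙 (((i <ᶠ j) ∧ allowed (ℓ i) (ℓ j)) ∧ E G i j)) ≡⟨ sum-cong-≗ (λ i → sum-cong-≗ λ j → cong 𝟙 (absorb (i <ᶠ j) i j)) ⟩
      ∑ (λ i → ∑ λ j → 𝟙 ((i <ᶠ j) ∧ E G i j))            ≡⟨ edgeCount-∑ G ⟨
      edgeCount G                                        ≡⟨ count ⟩
      m                                                  ∎
      where open ≡-Reasoning

    sound : ∀ i j → (i , j) ∈ edges → E G i j ≡ true
    sound i j p = Equivalence.to T-≡ (proj₂ (∈-filter⁻ _ {xs = allowedPairs ℓ} p))

    listed : ∀ i j → toℕ i < toℕ j → E G i j ≡ true → (i , j) ∈ edges
    listed i j i<j eᵢⱼ = ∈-filter⁺ _ (∈-filter⁺ _ (∈-allPairs i j)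
      (Equivalence.from T-≡ (cong₂ _∧_ (Equivalence.to T-≡ (<⇒<ᵇ i<j)) (E⇒allowed i j eᵢⱼ))))
      (Equivalence.from T-≡ eᵢⱼ)

    complete : ∀ i j → E G i j ≡ true → (i , j) ∈ edges ⊎ (j , i) ∈ edges
    complete i j eᵢⱼ with <-cmp (toℕ i) (toℕ j)
    ... | tri< i<j _ _ = inj₁ (listed i j i<j eᵢⱼ)
    ... | tri> _ _ j<i = inj₂ (listed j i j<i (trans (G-sym j i) eᵢⱼ))
    ... | tri≈ _ i≡j _ with refl ← toℕ-injective i≡j with () ← trans (sym eᵢⱼ) (loopless i)

-- Ratios of binomial coefficients

-- The identity behind `C-suc` with n - m moved to the other side: free of subtraction, it follows
-- by induction from Pascal's rule.
absorption : ∀ n m → suc m * (n C suc m) + m * (n C m) ≡ n * (n C m)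
absorption zero    zero    = refl
absorption zero    (suc m) = cong₂ _+_ (*-zeroʳ m) (*-zeroʳ m)
absorption (suc n) zero    = trans (+-identityʳ _) (trans (*-identityˡ _) (trans (nC1≡n (suc n)) (sym (*-identityʳ (suc n)))))
absorption (suc n) (suc m)
  rewrite sym (nCk+nC[k+1]≡[n+1]C[k+1] n m) | sym (nCk+nC[k+1]≡[n+1]C[k+1] n (suc m)) = begin
  suc (suc m) * (b + c) + suc m * (a + b)                         ≡⟨ split m a b c ⟩
  (suc (suc m) * c + suc m * b) + (suc m * b + m * a) + (a + b)   ≡⟨ cong (_+ (a + b)) (cong₂ _+_ (absorption n (suc m)) (absorption n m)) ⟩
  n * b + n * a + (a + b)                                         ≡⟨ merge n a b ⟩
  suc n * (a + b)                                                 ∎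
  where
  open ≡-Reasoning
  a = n C m
  b = n C suc m
  c = n C suc (suc m)
  split : ∀ m a b c → suc (suc m) * (b + c) + suc m * (a + b) ≡ (suc (suc m) * c + suc m * b) + (suc m * b + m * a) + (a + b)
  split = solve-∀
  merge : ∀ n a b → n * b + n * a + (a + b) ≡ suc n * (a + b)
  merge = solve-∀

C-suc : ∀ n m → suc m * (n C suc m) ≡ (n ∸ m) * (n C m)
C-suc n m = begin
  suc m * (n C suc m)                              ≡⟨ m+n∸n≡m _ (m * (n C m)) ⟨
  suc m * (n C suc m) + m * (n C m) ∸ m * (n C m)  ≡⟨ cong (_∸ m * (n C m)) (absorption n m) ⟩
  n * (n C m) ∸ m * (n C m)                        ≡⟨ *-distribʳ-∸ (n C m) n m ⟨
  (n ∸ m) * (n C m)                                ∎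
  where open ≡-Reasoning

2*nC2+n : ∀ n → 2 * (n C 2) + n ≡ n * n
2*nC2+n n = begin
  2 * (n C 2) + n            ≡⟨ cong (2 * (n C 2) +_) (trans (*-identityˡ (n C 1)) (nC1≡n n)) ⟨
  2 * (n C 2) + 1 * (n C 1)  ≡⟨ absorption n 1 ⟩
  n * (n C 1)                ≡⟨ cong (n *_) (nC1≡n n) ⟩
  n * n                      ∎
  where open ≡-Reasoning

-- The quotient of the two binomials is a product of factors (M′ - i) / (M - i), and each is at most
-- u / v because M′ / M ≤ u / v ≤ 1.
C-ratio : ∀ u v M′ M → u ≤ v → v * M′ ≤ u * M → ∀ m → (M′ C m) * v ^ m ≤ (M C m) * u ^ m
C-ratio u v M′ M u≤v ratio zero    = ≤-refl
C-ratio u v M′ M u≤v ratio (suc m) = *-cancelˡ-≤ (suc m) (begin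
  suc m * ((M′ C suc m) * (v * v ^ m))   ≡⟨ *-assoc (suc m) (M′ C suc m) (v * v ^ m) ⟨
  suc m * (M′ C suc m) * (v * v ^ m)     ≡⟨ cong (_* (v * v ^ m)) (C-suc M′ m) ⟩
  (M′ ∸ m) * (M′ C m) * (v * v ^ m)      ≡⟨ interchange (M′ ∸ m) (M′ C m) v (v ^ m) ⟩
  v * (M′ ∸ m) * ((M′ C m) * v ^ m)      ≤⟨ *-mono-≤ step-ratio (C-ratio u v M′ M u≤v ratio m) ⟩
  u * (M ∸ m) * ((M C m) * u ^ m)        ≡⟨ interchange (M ∸ m) (M C m) u (u ^ m) ⟨
  (M ∸ m) * (M C m) * (u * u ^ m)        ≡⟨ cong (_* (u * u ^ m)) (C-suc M m) ⟨
  suc m * (M C suc m) * (u * u ^ m)      ≡⟨ *-assoc (suc m) (M C suc m) (u * u ^ m) ⟩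
  suc m * ((M C suc m) * (u * u ^ m))    ∎)
  where
  open ≤-Reasoning
  interchange : ∀ a b c d → a * b * (c * d) ≡ c * a * (b * d)
  interchange = solve-∀
  step-ratio : v * (M′ ∸ m) ≤ u * (M ∸ m)
  step-ratio = begin
    v * (M′ ∸ m)      ≡⟨ *-distribˡ-∸ v M′ m ⟩
    v * M′ ∸ v * m    ≤⟨ ∸-mono ratio (*-monoˡ-≤ m u≤v) ⟩
    u * M ∸ u * m     ≡⟨ *-distribˡ-∸ u M m ⟨
    u * (M ∸ m)       ∎

-- Counting labellings with few separator labels

labellings : ∀ q n → List (Vec (Fin q) n)
labellings q zero    = [] ∷ []
labellings q (suc n) = cartesianProductWith _∷_ (allFin q) (labellings q n)

∈-labellings : ∀ {q n} (ℓ : Vec (Fin q) n) → ℓ ∈ labellings q n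
∈-labellings []      = here refl
∈-labellings (c ∷ ℓ) = ∈-cartesianProductWith⁺ _∷_ (∈-allFin c) (∈-labellings ℓ)

-- Weighting each non-separator label by Y counts the labellings with few separator labels: by
-- Markov's inequality the union bound pays (1 + r Y) / Y, which is close to r, per vertex.
module _ (Y : ℕ) where

  labelWeight : ∀ {r} → Fin (suc r) → ℕ
  labelWeight zero    = 1
  labelWeight (suc _) = Y

  weight : ∀ {n r} → Vec (Fin (suc r)) n → ℕ
  weight []      = 1
  weight (c ∷ ℓ) = labelWeight c * weight ℓ

  totalWeight : ∀ {n r} → List (Vec (Fin (suc r)) n) → ℕ
  totalWeight = sumᴸ ∘ map weight

  totalWeight-cons : ∀ {n r} (c : Fin (suc r)) (ℓs : List (Vec (Fin (suc r)) n)) →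
    totalWeight (map (c ∷_) ℓs) ≡ labelWeight c * totalWeight ℓs
  totalWeight-cons c []       = sym (*-zeroʳ (labelWeight c))
  totalWeight-cons c (ℓ ∷ ℓs) = trans (cong (labelWeight c * weight ℓ +_) (totalWeight-cons c ℓs))
    (sym (*-distribˡ-+ (labelWeight c) (weight ℓ) (totalWeight ℓs)))

  totalWeight-product : ∀ {k n r} (f : Fin k → Fin (suc r)) (ℓs : List (Vec (Fin (suc r)) n)) →
    totalWeight (cartesianProductWith _∷_ (tabulate f) ℓs) ≡ ∑ (labelWeight ∘ f) * totalWeight ℓs
  totalWeight-product {zero}  f ℓs = refl
  totalWeight-product {suc k} f ℓs = begin
    sumᴸ (map weight (map (f zero ∷_) ℓs ++ rest))                                ≡⟨ cong sumᴸ (map-++ weight (map (f zero ∷_) ℓs) rest) ⟩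
    sumᴸ (map weight (map (f zero ∷_) ℓs) ++ map weight rest)                     ≡⟨ sum-++ (map weight (map (f zero ∷_) ℓs)) (map weight rest) ⟩
    totalWeight (map (f zero ∷_) ℓs) + totalWeight rest                           ≡⟨ cong₂ _+_ (totalWeight-cons (f zero) ℓs) (totalWeight-product (f ∘ suc) ℓs) ⟩
    labelWeight (f zero) * totalWeight ℓs + ∑ (labelWeight ∘ f ∘ suc) * totalWeight ℓs ≡⟨ *-distribʳ-+ (totalWeight ℓs) (labelWeight (f zero)) _ ⟨
    ∑ (labelWeight ∘ f) * totalWeight ℓs                                          ∎
    where
    open ≡-Reasoning
    rest = cartesianProductWith _∷_ (tabulate (f ∘ suc)) ℓs

  totalWeight-labellings : ∀ r n → totalWeight (labellings (suc r) n) ≡ (1 + r * Y) ^ n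
  totalWeight-labellings r zero    = refl
  totalWeight-labellings r (suc n) = trans (totalWeight-product id (labellings (suc r) n))
    (cong₂ (λ a b → (1 + a) * b) (∑-const r Y) (totalWeight-labellings r n))

  weight-size : ∀ {n r} (ℓ : Vec (Fin (suc r)) n) → Y ^ n ≡ Y ^ size (lookup ℓ) zero * weight ℓ
  weight-size []          = refl
  weight-size (zero ∷ ℓ)  = trans (cong (Y *_) (weight-size ℓ)) (trans (sym (*-assoc Y _ (weight ℓ))) (cong (Y * Y ^ size (lookup ℓ) zero *_) (sym (*-identityˡ (weight ℓ)))))
  weight-size (suc _ ∷ ℓ) = trans (cong (Y *_) (weight-size ℓ)) (swap Y (Y ^ size (lookup ℓ) zero) (weight ℓ))
    where
    swap : ∀ a b c → a * (b * c) ≡ b * (a * c)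
    swap = solve-∀

-- Markov's inequality without division: each element that passes carries weight at least a / b.
length-filter-weighted : ∀ {A : Set} {P : A → Set} (P? : ∀ x → Dec (P x)) (w : A → ℕ) a b →
  (∀ x → P x → a ≤ b * w x) → ∀ xs → length (filter P? xs) * a ≤ b * sumᴸ (map w xs)
length-filter-weighted P? w a b bound [] = z≤n
length-filter-weighted P? w a b bound (x ∷ xs) with P? x
... | yes p = ≤-trans (+-mono-≤ (bound x p) (length-filter-weighted P? w a b bound xs))
                      (≤-reflexive (sym (*-distribˡ-+ b (w x) _)))
... | no _  = ≤-trans (length-filter-weighted P? w a b bound xs) (*-monoʳ-≤ b (m≤n+m _ (w x)))

-- The union bound in counting form.
length-concatMap-filter : ∀ {A B : Set} {P : A → Set} (P? : ∀ x → Dec (P x)) (f : A → List B) a b →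
  (∀ x → P x → length (f x) * a ≤ b) → ∀ xs → length (concatMap f (filter P? xs)) * a ≤ length (filter P? xs) * b
length-concatMap-filter P? f a b bound [] = z≤n
length-concatMap-filter P? f a b bound (x ∷ xs) with P? x
... | no _  = length-concatMap-filter P? f a b bound xs
... | yes p = begin
  length (f x ++ concatMap f (filter P? xs)) * a          ≡⟨ cong (_* a) (length-++ (f x)) ⟩
  (length (f x) + length (concatMap f (filter P? xs))) * a ≡⟨ *-distribʳ-+ a (length (f x)) _ ⟩
  length (f x) * a + length (concatMap f (filter P? xs)) * a ≤⟨ +-mono-≤ (bound x p) (length-concatMap-filter P? f a b bound xs) ⟩
  b + length (filter P? xs) * b                            ∎
  where open ≤-Reasoning

-- Exponential estimates for the union bound

^-distribʳ-* : ∀ x y n → (x * y) ^ n ≡ x ^ n * y ^ n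
^-distribʳ-* x y zero    = refl
^-distribʳ-* x y (suc n) = trans (cong (x * y *_) (^-distribʳ-* x y n)) (interchange x y (x ^ n) (y ^ n))
  where
  interchange : ∀ a b c d → a * b * (c * d) ≡ a * c * (b * d)
  interchange = solve-∀

^-swap : ∀ x m n → (x ^ m) ^ n ≡ (x ^ n) ^ m
^-swap x m n = trans (^-*-assoc x m n) (trans (cong (x ^_) (*-comm m n)) (sym (^-*-assoc x n m)))

^-cancelˡ-≤ : ∀ {x y} e .{{_ : NonZero e}} → x ^ e ≤ y ^ e → x ≤ y
^-cancelˡ-≤ {x} {y} e x^e≤y^e with x ≤? y
... | yes x≤y = x≤y
... | no x≰y  = contradiction x^e≤y^e (<⇒≱ (^-monoˡ-< e (≰⇒> x≰y)))

-- Bernoulli's inequality (V / U) ^ j ≥ 1 + j / U, cleared of denominators.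
bernoulli : ∀ U V → U < V → ∀ j → (U + j) * U ^ j ≤ U * V ^ j
bernoulli U V U<V zero    = ≤-reflexive (cong (_* 1) (+-identityʳ U))
bernoulli U V U<V (suc j) = begin
  (U + suc j) * (U * U ^ j)      ≤⟨ m≤m+n _ (j * U ^ j) ⟩
  (U + suc j) * (U * U ^ j) + j * U ^ j ≡⟨ regroup-terms U j (U ^ j) ⟩
  suc U * ((U + j) * U ^ j)      ≤⟨ *-mono-≤ U<V (bernoulli U V U<V j) ⟩
  V * (U * V ^ j)                ≡⟨ swap V U (V ^ j) ⟩
  U * (V * V ^ j)                ∎
  where
  open ≤-Reasoning
  regroup-terms : ∀ U j x → (U + suc j) * (U * x) + j * x ≡ suc U * ((U + j) * x)
  regroup-terms = solve-∀
  swap : ∀ a b c → a * (b * c) ≡ b * (a * c)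
  swap = solve-∀

exponential-growth : ∀ U V .{{_ : NonZero U}} → U < V → ∀ D j → U * D ≤ j → D * U ^ j ≤ V ^ j
exponential-growth U V U<V D j UD≤j = *-cancelˡ-≤ U (begin
  U * (D * U ^ j)   ≡⟨ *-assoc U D (U ^ j) ⟨
  U * D * U ^ j     ≤⟨ *-monoˡ-≤ (U ^ j) (≤-trans UD≤j (m≤n+m j U)) ⟩
  (U + j) * U ^ j   ≤⟨ bernoulli U V U<V j ⟩
  U * V ^ j         ∎)
  where open ≤-Reasoning

-- The claim D K (u / v) ^ m ≤ 1 is proved after raising it to the e-th power, which turns the
-- bound m ≥ (f / e) n into one on integer exponents.
first-moment : ∀ Y A u v e f Q D K n m s j .{{_ : NonZero Y}} .{{_ : NonZero v}} .{{_ : NonZero e}} →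
  let U = A ^ e * u ^ f
      V = Y ^ e * v ^ f in
  u ≤ v → K * Y ^ n ≤ Y ^ s * A ^ n → n * f ≤ m * e → Y ^ e * U ^ Q ≤ V ^ Q →
  D ^ e * U ^ j ≤ V ^ j → n ≡ s * Q + j → D * K * u ^ m ≤ v ^ m
first-moment Y A u v e f Q D K n m s j u≤v few edges gain large n≡ =
  ^-cancelˡ-≤ e (*-cancelʳ-≤ _ _ (V ^ n) {{m^n≢0 V n {{V≢0}}}} (begin
    (D * K * u ^ m) ^ e * V ^ n
      ≡⟨ cong₂ _*_ lhs-power V-power ⟩
    D ^ e * K ^ e * u ^ (m * e) * ((Y ^ n) ^ e * v ^ (n * f))
      ≡⟨ gather (D ^ e) (K ^ e) (u ^ (m * e)) ((Y ^ n) ^ e) (v ^ (n * f)) ⟩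
    D ^ e * (K ^ e * (Y ^ n) ^ e) * (u ^ (m * e) * v ^ (n * f))
      ≡⟨ cong (λ z → D ^ e * z * (u ^ (m * e) * v ^ (n * f))) (^-distribʳ-* K (Y ^ n) e) ⟨
    D ^ e * (K * Y ^ n) ^ e * (u ^ (m * e) * v ^ (n * f))
      ≤⟨ *-mono-≤ (*-monoʳ-≤ (D ^ e) (^-monoˡ-≤ e few)) exchange ⟩
    D ^ e * (Y ^ s * A ^ n) ^ e * (u ^ (n * f) * v ^ (m * e))
      ≡⟨ cong₂ (λ a b → D ^ e * a * (u ^ (n * f) * b))
           (trans (^-distribʳ-* (Y ^ s) (A ^ n) e) (cong₂ _*_ (^-swap Y s e) (^-swap A n e)))
           (sym (^-*-assoc v m e)) ⟩
    D ^ e * ((Y ^ e) ^ s * (A ^ e) ^ n) * (u ^ (n * f) * (v ^ m) ^ e)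
      ≡⟨ gather′ (D ^ e) ((Y ^ e) ^ s) ((A ^ e) ^ n) (u ^ (n * f)) ((v ^ m) ^ e) ⟩
    D ^ e * (Y ^ e) ^ s * ((A ^ e) ^ n * u ^ (n * f)) * (v ^ m) ^ e
      ≡⟨ cong (λ z → D ^ e * (Y ^ e) ^ s * z * (v ^ m) ^ e) U-power ⟩
    D ^ e * (Y ^ e) ^ s * ((U ^ Q) ^ s * U ^ j) * (v ^ m) ^ e
      ≡⟨ cong (_* (v ^ m) ^ e) (gather″ (D ^ e) ((Y ^ e) ^ s) ((U ^ Q) ^ s) (U ^ j)) ⟩
    D ^ e * U ^ j * ((Y ^ e) ^ s * (U ^ Q) ^ s) * (v ^ m) ^ e
      ≡⟨ cong (λ z → D ^ e * U ^ j * z * (v ^ m) ^ e) (^-distribʳ-* (Y ^ e) (U ^ Q) s) ⟨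
    -- The n vertices are split as s blocks of Q and a rest of j. Each block gains (V / U)^Q, which
    -- pays the factor `Y ^ e` of one separator label; the rest pays for `D ^ e`.
    D ^ e * U ^ j * (Y ^ e * U ^ Q) ^ s * (v ^ m) ^ e
      ≤⟨ *-monoˡ-≤ ((v ^ m) ^ e) (*-mono-≤ large (^-monoˡ-≤ s gain)) ⟩
    V ^ j * (V ^ Q) ^ s * (v ^ m) ^ e
      ≡⟨ trans (cong (_* (v ^ m) ^ e) (trans (*-comm (V ^ j) ((V ^ Q) ^ s)) (sym (power-split V)))) (*-comm (V ^ n) _) ⟩
    (v ^ m) ^ e * V ^ n ∎))
  where
  open ≤-Reasoning
  U = A ^ e * u ^ f
  V = Y ^ e * v ^ f
  V≢0 : NonZero V
  V≢0 = m*n≢0 (Y ^ e) (v ^ f) {{m^n≢0 Y e}} {{m^n≢0 v f}}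
  power-split : ∀ W → W ^ n ≡ (W ^ Q) ^ s * W ^ j
  power-split W = trans (cong (W ^_) n≡) (trans (^-distribˡ-+-* W (s * Q) j)
    (cong (_* W ^ j) (trans (cong (W ^_) (*-comm s Q)) (sym (^-*-assoc W Q s)))))
  gather : ∀ d k x y z → d * k * x * (y * z) ≡ d * (k * y) * (x * z)
  gather = solve-∀
  gather′ : ∀ d y a x z → d * (y * a) * (x * z) ≡ d * y * (a * x) * z
  gather′ = solve-∀
  gather″ : ∀ d y a x → d * y * (a * x) ≡ d * x * (y * a)
  gather″ = solve-∀
  n*f-power : ∀ w → w ^ (n * f) ≡ (w ^ f) ^ n
  n*f-power w = trans (cong (w ^_) (*-comm n f)) (sym (^-*-assoc w f n))
  lhs-power : (D * K * u ^ m) ^ e ≡ D ^ e * K ^ e * u ^ (m * e)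
  lhs-power = trans (^-distribʳ-* (D * K) (u ^ m) e) (cong₂ _*_ (^-distribʳ-* D K e) (^-*-assoc u m e))
  V-power : V ^ n ≡ (Y ^ n) ^ e * v ^ (n * f)
  V-power = trans (^-distribʳ-* (Y ^ e) (v ^ f) n) (cong₂ _*_ (^-swap Y e n) (sym (n*f-power v)))
  U-power : (A ^ e) ^ n * u ^ (n * f) ≡ (U ^ Q) ^ s * U ^ j
  U-power = trans (cong ((A ^ e) ^ n *_) (n*f-power u)) (trans (sym (^-distribʳ-* (A ^ e) (u ^ f) n)) (power-split U))
  x = m * e ∸ n * f
  m*e-split : ∀ w → w ^ (m * e) ≡ w ^ (n * f) * w ^ x
  m*e-split w = trans (cong (w ^_) (sym (m+[n∸m]≡n edges))) (^-distribˡ-+-* w (n * f) x)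
  -- Edges beyond n f / e only help, each contributing a factor u / v ≤ 1.
  exchange : u ^ (m * e) * v ^ (n * f) ≤ u ^ (n * f) * v ^ (m * e)
  exchange = begin
    u ^ (m * e) * v ^ (n * f)            ≡⟨ cong (_* v ^ (n * f)) (m*e-split u) ⟩
    u ^ (n * f) * u ^ x * v ^ (n * f)    ≤⟨ *-monoˡ-≤ (v ^ (n * f)) (*-monoʳ-≤ (u ^ (n * f)) (^-monoˡ-≤ x u≤v)) ⟩
    u ^ (n * f) * v ^ x * v ^ (n * f)    ≡⟨ trans (*-assoc (u ^ (n * f)) _ _) (cong (u ^ (n * f) *_) (*-comm (v ^ x) _)) ⟩
    u ^ (n * f) * (v ^ (n * f) * v ^ x)  ≡⟨ cong (u ^ (n * f) *_) (m*e-split v) ⟨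
    u ^ (n * f) * v ^ (m * e)            ∎

-- Edge density of good labellings

-- In units of n² / w, twice `M′` is at most ρ + e, where e ≥ 2 w / f pays for the pairs meeting the
-- separator. Twice `M` falls short of n² by the linear term n, which the margin t absorbs once n ≥
-- N.
density : ∀ s n Q M′ M u v ρ t w e f N .{{_ : NonZero w}} →
  2 * M′ ≤ s * n + n * s + Q → s * f ≤ n → w * 2 ≤ f * e → Q * w ≤ n * n * ρ → 2 * M + n ≡ n * n →
  v * (ρ + e) + t ≤ u * w → u * w ≤ t * N → N ≤ n → v * M′ ≤ u * M
density s n Q M′ M u v ρ t w e f N pairs sep w≤ squares nC2 margin large N≤n =
  *-cancelʳ-≤ _ _ (2 * w) {{m*n≢0 2 w}} (+-cancelʳ-≤ (u * w * n) _ _ (begin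
    v * M′ * (2 * w) + u * w * n                     ≤⟨ +-mono-≤ main error ⟩
    v * (ρ + e) * (n * n) + t * (n * n)              ≡⟨ *-distribʳ-+ (n * n) (v * (ρ + e)) t ⟨
    (v * (ρ + e) + t) * (n * n)                      ≤⟨ *-monoˡ-≤ (n * n) margin ⟩
    u * w * (n * n)                                  ≡⟨ cong (u * w *_) nC2 ⟨
    u * w * (2 * M + n)                              ≡⟨ expand u w M n ⟩
    u * M * (2 * w) + u * w * n                      ∎))
  where
  open ≤-Reasoning
  expand : ∀ u w M n → u * w * (2 * M + n) ≡ u * M * (2 * w) + u * w * n
  expand = solve-∀
  e₁ : ∀ v M w → v * M * (2 * w) ≡ 2 * M * (v * w)
  e₁ = solve-∀
  e₂ : ∀ s n Q v w → (s * n + n * s + Q) * (v * w) ≡ v * (w * 2 * (s * n) + Q * w)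
  e₂ = solve-∀
  e₃ : ∀ v f e s n ρ → v * (f * e * (s * n) + n * n * ρ) ≡ v * (s * f * (e * n) + n * n * ρ)
  e₃ = solve-∀
  e₄ : ∀ v n e ρ → v * (n * (e * n) + n * n * ρ) ≡ v * (ρ + e) * (n * n)
  e₄ = solve-∀
  main : v * M′ * (2 * w) ≤ v * (ρ + e) * (n * n)
  main = begin
    v * M′ * (2 * w)                         ≡⟨ e₁ v M′ w ⟩
    2 * M′ * (v * w)                         ≤⟨ *-monoˡ-≤ (v * w) pairs ⟩
    (s * n + n * s + Q) * (v * w)            ≡⟨ e₂ s n Q v w ⟩
    v * (w * 2 * (s * n) + Q * w)            ≤⟨ *-monoʳ-≤ v (+-mono-≤ (*-monoˡ-≤ (s * n) w≤) squares) ⟩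
    v * (f * e * (s * n) + n * n * ρ)        ≡⟨ e₃ v f e s n ρ ⟩
    v * (s * f * (e * n) + n * n * ρ)        ≤⟨ *-monoʳ-≤ v (+-monoˡ-≤ (n * n * ρ) (*-monoˡ-≤ (e * n) sep)) ⟩
    v * (n * (e * n) + n * n * ρ)            ≡⟨ e₄ v n e ρ ⟩
    v * (ρ + e) * (n * n)                    ∎
  error : u * w * n ≤ t * (n * n)
  error = begin
    u * w * n      ≤⟨ *-monoˡ-≤ n large ⟩
    t * N * n      ≤⟨ *-monoˡ-≤ n (*-monoʳ-≤ t N≤n) ⟩
    t * n * n      ≡⟨ *-assoc t n n ⟩
    t * (n * n)    ∎

square-scale : ∀ p k → p * p * (k * k) ≡ p * k * (p * k)
square-scale = solve-∀

∑-sizes-scaled : ∀ {n q} (ℓ : Fin n → Fin (suc q)) k → ∑ (λ c → size ℓ (suc c) * k) ≤ n * k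
∑-sizes-scaled ℓ k = ≤-trans (≤-reflexive (sym (*-distribʳ-sum k (λ c → size ℓ (suc c))))) (*-monoˡ-≤ k (∑-sizes ℓ))

-- The extremal parts are 151n/250 and 99n/250: 32602 = 151² + 99² and 62500 = 250².
good₂-squares : ∀ {n} (ℓ : Fin n → Fin 3) → Good 151 ℓ →
  (∑ λ c → size ℓ (suc c) * size ℓ (suc c)) * 62500 ≤ n * n * 32602
good₂-squares {n} ℓ (_ , parts) = begin
  (x * x + (y * y + 0)) * 62500            ≡⟨ cong (λ z → (x * x + z) * 62500) (+-identityʳ (y * y)) ⟩
  (x * x + y * y) * 62500                  ≡⟨ *-distribʳ-+ 62500 (x * x) (y * y) ⟩
  x * x * 62500 + y * y * 62500            ≡⟨ cong₂ _+_ (square-scale x 250) (square-scale y 250) ⟩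
  x * 250 * (x * 250) + y * 250 * (y * 250) ≤⟨ squares₂ (n * 151) (n * 99) (x * 250) (y * 250) (parts 0F) (parts 1F) total ⟩
  n * 151 * (n * 151) + n * 99 * (n * 99)  ≡⟨ cong₂ _+_ (square-scale n 151) (square-scale n 99) ⟨
  n * n * 22801 + n * n * 9801             ≡⟨ *-distribˡ-+ (n * n) 22801 9801 ⟨
  n * n * 32602                            ∎
  where
  open ≤-Reasoning
  x = size ℓ 1F
  y = size ℓ 2F
  total : x * 250 + y * 250 ≤ n * 151 + n * 99
  total = begin
    x * 250 + y * 250        ≡⟨ cong (x * 250 +_) (+-identityʳ (y * 250)) ⟨
    x * 250 + (y * 250 + 0)  ≤⟨ ∑-sizes-scaled ℓ 250 ⟩
    n * 250                  ≡⟨ *-distribˡ-+ n 151 99 ⟩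
    n * 151 + n * 99         ∎

-- The extremal parts are two of 99n/250 and a rest of 52n/250, as 250 - 2 · 99 = 52; thus 22306 = 2
-- · 99² + 52².
good₃-squares : ∀ {n} (ℓ : Fin n → Fin 4) → Good 99 ℓ →
  (∑ λ c → size ℓ (suc c) * size ℓ (suc c)) * 62500 ≤ n * n * 22306
good₃-squares {n} ℓ (_ , parts) = begin
  (x * x + (y * y + (z * z + 0))) * 62500                           ≡⟨ cong (λ a → (x * x + (y * y + a)) * 62500) (+-identityʳ (z * z)) ⟩
  (x * x + (y * y + z * z)) * 62500                                 ≡⟨ trans (*-distribʳ-+ 62500 (x * x) (y * y + z * z)) (cong (x * x * 62500 +_) (*-distribʳ-+ 62500 (y * y) (z * z))) ⟩
  x * x * 62500 + (y * y * 62500 + z * z * 62500)                   ≡⟨ cong₂ _+_ (square-scale x 250) (cong₂ _+_ (square-scale y 250) (square-scale z 250)) ⟩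
  x * 250 * (x * 250) + (y * 250 * (y * 250) + z * 250 * (z * 250)) ≤⟨ squares₃ (n * 99) (n * 52) (x * 250) (y * 250) (z * 250) (parts 0F) (parts 1F) (parts 2F) total ⟩
  n * 99 * (n * 99) + (n * 99 * (n * 99) + n * 52 * (n * 52))       ≡⟨ cong₂ _+_ (square-scale n 99) (cong₂ _+_ (square-scale n 99) (square-scale n 52)) ⟨
  n * n * 9801 + (n * n * 9801 + n * n * 2704)                      ≡⟨ trans (*-distribˡ-+ (n * n) 9801 12505) (cong (n * n * 9801 +_) (*-distribˡ-+ (n * n) 9801 2704)) ⟨
  n * n * 22306                                                     ∎
  where
  open ≤-Reasoning
  x = size ℓ 1F
  y = size ℓ 2F
  z = size ℓ (suc 2F)
  total : x * 250 + (y * 250 + z * 250) ≤ n * 99 + (n * 99 + n * 52)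
  total = begin
    x * 250 + (y * 250 + z * 250)        ≡⟨ cong (λ a → x * 250 + (y * 250 + a)) (+-identityʳ (z * 250)) ⟨
    x * 250 + (y * 250 + (z * 250 + 0))  ≤⟨ ∑-sizes-scaled ℓ 250 ⟩
    n * 250                              ≡⟨ trans (*-distribˡ-+ n 99 151) (cong (n * 99 +_) (*-distribˡ-+ n 99 52)) ⟩
    n * 99 + (n * 99 + n * 52)           ∎

good? : ∀ {n r} θ (ℓ : Fin n → Fin (suc r)) → Dec (Good θ ℓ)
good? {n} θ ℓ = (size ℓ zero * 10000 ≤? n) ×-dec all? (λ c → size ℓ (suc c) * 250 ≤? n * θ)

size-cong : ∀ {n q} {ℓ ℓ′ : Fin n → Fin q} → (∀ i → ℓ i ≡ ℓ′ i) → ∀ c → size ℓ c ≡ size ℓ′ c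
size-cong ℓ≗ℓ′ c = sum-cong-≗ λ i → cong (λ a → δ a c) (ℓ≗ℓ′ i)

good-cong : ∀ {n r θ} {ℓ ℓ′ : Fin n → Fin (suc r)} → (∀ i → ℓ i ≡ ℓ′ i) → Good θ ℓ → Good θ ℓ′
good-cong {n} {θ = θ} ℓ≗ℓ′ (sep , parts) =
  subst (λ s → s * 10000 ≤ n) (size-cong ℓ≗ℓ′ zero) sep ,
  λ c → subst (λ s → s * 250 ≤ n * θ) (size-cong ℓ≗ℓ′ (suc c)) (parts c)

-- The union bound over labellings

module LabelledGraphs (r θ : ℕ) where

  goodLabellings : ∀ n → List (Vec (Fin (suc r)) n)
  goodLabellings n = filter (λ ℓ → good? θ (lookup ℓ)) (labellings (suc r) n)

  labelledGraphs : ∀ n → ℕ → List (Graph n)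
  labelledGraphs n m = concatMap (λ ℓ → graphs m (lookup ℓ)) (goodLabellings n)

  ∈-labelledGraphs : ∀ {n} m (G : Graph n) → IsGnm n m G → GoodLabelling G r θ → G ∈ labelledGraphs n m
  ∈-labelledGraphs {n} m G gnm (ℓ , respects , good) =
    ∈-concatMap⁺ (λ ℓ → graphs m (lookup ℓ)) (lose
      (∈-filter⁺ (λ ℓ → good? θ (lookup ℓ)) (∈-labellings ℓⱽ) (good-cong ℓ≗ good))
      (∈-graphs m (lookup ℓⱽ) G gnm λ i j eᵢⱼ → subst₂ Compatible (ℓ≗ i) (ℓ≗ j) (respects i j eᵢⱼ)))
    where
    ℓⱽ = tabulateⱽ ℓ
    ℓ≗ : ∀ i → ℓ i ≡ lookup ℓⱽ i
    ℓ≗ i = sym (lookup∘tabulate ℓ i)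

  length-goodLabellings : ∀ Y .{{_ : NonZero Y}} n →
    length (goodLabellings n) * Y ^ n ≤ Y ^ (n / 10000) * (1 + r * Y) ^ n
  length-goodLabellings Y n = begin
    length (goodLabellings n) * Y ^ n                          ≤⟨ length-filter-weighted (λ ℓ → good? θ (lookup ℓ)) (weight Y) (Y ^ n) (Y ^ (n / 10000)) heavy (labellings (suc r) n) ⟩
    Y ^ (n / 10000) * totalWeight Y (labellings (suc r) n)     ≡⟨ cong (Y ^ (n / 10000) *_) (totalWeight-labellings Y r n) ⟩
    Y ^ (n / 10000) * (1 + r * Y) ^ n                          ∎
    where
    open ≤-Reasoning
    heavy : ∀ ℓ → Good θ (lookup ℓ) → Y ^ n ≤ Y ^ (n / 10000) * weight Y ℓ
    heavy ℓ (sep , _) = ≤-trans (≤-reflexive (weight-size Y ℓ)) (*-monoˡ-≤ (weight Y ℓ) (^-monoʳ-≤ Y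
      (≤-trans (≤-reflexive (sym (m*n/n≡m (size (lookup ℓ) zero) 10000))) (/-monoˡ-≤ 10000 sep))))

  length-labelledGraphs : ∀ {n} m u v → u ≤ v →
    (∀ (ℓ : Fin n → Fin (suc r)) → Good θ ℓ → v * length (allowedPairs ℓ) ≤ u * (n C 2)) →
    length (labelledGraphs n m) * v ^ m ≤ length (goodLabellings n) * (((n C 2) C m) * u ^ m)
  length-labelledGraphs {n} m u v u≤v dense = length-concatMap-filter (λ ℓ → good? θ (lookup ℓ)) _ (v ^ m) _
    (λ ℓ good → subst (λ x → x * v ^ m ≤ ((n C 2) C m) * u ^ m) (sym (length-graphs m (lookup ℓ)))
      (C-ratio u v (length (allowedPairs (lookup ℓ))) (n C 2) u≤v (dense (lookup ℓ) good) m))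
    (labellings (suc r) n)

  module _ (Y u v e f Q : ℕ) .{{_ : NonZero Y}} .{{_ : NonZero v}} .{{_ : NonZero e}} (Q≤5000 : Q ≤ 5000) (u≤v : u ≤ v)
    (dense : ∀ {n} → 20000 ≤ n → (ℓ : Fin n → Fin (suc r)) → Good θ ℓ → v * length (allowedPairs ℓ) ≤ u * (n C 2)) where

    private
      U = (1 + r * Y) ^ e * u ^ f
      V = Y ^ e * v ^ f

    labelledGraphs-rare : .{{_ : NonZero U}} → U < V → Y ^ e * U ^ Q ≤ V ^ Q →
      ∀ D → ∃ λ N → ∀ n m → N ≤ n → n * f ≤ m * e → D * length (labelledGraphs n m) ≤ (n C 2) C m
    -- Since s ≤ n / 10000 and Q ≤ 5000, the s blocks use at most half of the vertices. Hence j ≥ n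
    -- / 2, and n ≥ 2 U D^e provides the j ≥ U D^e that Bernoulli's inequality asks for; 20000 is
    -- the threshold of `dense`.
    labelledGraphs-rare U<V gain D = U * D ^ e * 2 + 20000 , λ n m N≤n edges →
      rare n m (m+n≤o⇒n≤o (U * D ^ e * 2) N≤n) (m+n≤o⇒m≤o (U * D ^ e * 2) N≤n) edges
      where
      open ≤-Reasoning
      gather : ∀ a b c d → a * (b * (c * d)) ≡ c * (a * b * d)
      gather = solve-∀
      rare : ∀ n m → 20000 ≤ n → U * D ^ e * 2 ≤ n → n * f ≤ m * e → D * length (labelledGraphs n m) ≤ (n C 2) C m
      rare n m n-large n-large′ edges = *-cancelʳ-≤ _ _ (v ^ m) {{m^n≢0 v m}} (begin
        D * length (labelledGraphs n m) * v ^ m    ≡⟨ *-assoc D _ (v ^ m) ⟩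
        D * (length (labelledGraphs n m) * v ^ m)  ≤⟨ *-monoʳ-≤ D (length-labelledGraphs m u v u≤v (dense n-large)) ⟩
        D * (K * (total * u ^ m))                  ≡⟨ gather D K total (u ^ m) ⟩
        total * (D * K * u ^ m)                    ≤⟨ *-monoʳ-≤ total (first-moment Y (1 + r * Y) u v e f Q D K n m s j
                                                        u≤v (length-goodLabellings Y n) edges gain
                                                        (exponential-growth U V U<V (D ^ e) j j-large) (sym (m+[n∸m]≡n sQ≤n))) ⟩
        total * v ^ m                              ∎)
        where
        K = length (goodLabellings n)
        total = (n C 2) C m
        s = n / 10000
        j = n ∸ s * Q
        2sQ≤n : s * Q * 2 ≤ n
        2sQ≤n = begin
          s * Q * 2    ≡⟨ *-assoc s Q 2 ⟩
          s * (Q * 2)  ≤⟨ *-monoʳ-≤ s (*-monoˡ-≤ 2 Q≤5000) ⟩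
          s * 10000    ≤⟨ m/n*n≤m n 10000 ⟩
          n            ∎
        sQ≤n : s * Q ≤ n
        sQ≤n = ≤-trans (m≤m*n (s * Q) 2) 2sQ≤n
        j-large : U * D ^ e ≤ j
        j-large = m+n≤o⇒m≤o∸n (U * D ^ e) (*-cancelʳ-≤ _ _ 2 (begin
          (U * D ^ e + s * Q) * 2    ≡⟨ *-distribʳ-+ 2 (U * D ^ e) (s * Q) ⟩
          U * D ^ e * 2 + s * Q * 2  ≤⟨ +-mono-≤ n-large′ 2sQ≤n ⟩
          n + n                      ≡⟨ cong (n +_) (+-identityʳ n) ⟨
          2 * n                      ≡⟨ *-comm 2 n ⟩
          n * 2                      ∎))

-- Numerical instances

module Bipartite = LabelledGraphs 2 151
module Tripartite = LabelledGraphs 3 99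

-- 13 ≥ 2 · 62500 / 10000 accounts for pairs meeting the separator, and 2150 and 34 are the
-- resulting margins 47 · 62500 − 90 · (32602 + 13) and 5 · 62500 − 14 · (22306 + 13).
dense₂ : ∀ {n} → 20000 ≤ n → (ℓ : Fin n → Fin 3) → Good 151 ℓ → 90 * length (allowedPairs ℓ) ≤ 47 * (n C 2)
dense₂ {n} n-large ℓ good = density (size ℓ zero) n _ (length (allowedPairs ℓ)) (n C 2) 47 90 32602 2150 62500 13 10000 20000
  (2*length-allowedPairs ℓ) (proj₁ good) (≤ᵇ⇒≤ _ _ tt) (good₂-squares ℓ good) (2*nC2+n n) (≤ᵇ⇒≤ _ _ tt) (≤ᵇ⇒≤ _ _ tt) n-large

dense₃ : ∀ {n} → 20000 ≤ n → (ℓ : Fin n → Fin 4) → Good 99 ℓ → 14 * length (allowedPairs ℓ) ≤ 5 * (n C 2)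
dense₃ {n} n-large ℓ good = density (size ℓ zero) n _ (length (allowedPairs ℓ)) (n C 2) 5 14 22306 34 62500 13 10000 20000
  (2*length-allowedPairs ℓ) (proj₁ good) (≤ᵇ⇒≤ _ _ tt) (good₃-squares ℓ good) (2*nC2+n n) (≤ᵇ⇒≤ _ _ tt) (≤ᵇ⇒≤ _ _ tt) n-large

-- Convergence of a probability to 0, in counting form: for every D the list is eventually at most 1
-- / D as long as the number of all graphs with m edges, uniformly in m ≥ 15 n / 14.
Rare : (∀ n → ℕ → List (Graph n)) → Set
Rare F = ∀ D → ∃ λ N → ∀ n m → N ≤ n → n * 15 ≤ m * 14 → D * length (F n m) ≤ (n C 2) C m

-- With Y = 1000 a vertex costs 2.001 labels, and 2.001^14 · (47/90)^15 is about 0.967, still below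
-- 1. The 3000th power of this is smaller than 1000^(-14), so one separator label is paid for by
-- 3000 vertices, within the permitted 5000.
rare₂ : Rare Bipartite.labelledGraphs
rare₂ = Bipartite.labelledGraphs-rare 1000 47 90 14 15 3000 (≤ᵇ⇒≤ _ _ tt) (≤ᵇ⇒≤ _ _ tt) dense₂ (<ᵇ⇒< _ _ tt) (≤ᵇ⇒≤ _ _ tt)

rare₃ : Rare Tripartite.labelledGraphs
rare₃ = Tripartite.labelledGraphs-rare 1000 5 14 14 15 3000 (≤ᵇ⇒≤ _ _ tt) (≤ᵇ⇒≤ _ _ tt) dense₃ (<ᵇ⇒< _ _ tt) (≤ᵇ⇒≤ _ _ tt)

-- Rounding and assembly

-- Rounding c n down costs at most one edge, worth 14000 after scaling. The excess of 1073 · 14 =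
-- 15022 over 15000 gives 22 n, which covers it.
enough-edges : ∀ a b n → 1073 * suc b ≤ 1000 * a → 20000 ≤ n → n * 15 ≤ mOf a b n * 14
enough-edges a b n ratio n-large = *-cancelʳ-≤ (n * 15) (m * 14) 1000 (+-cancelʳ-≤ 14000 (n * 15 * 1000) (m * 14 * 1000) (begin
  n * 15 * 1000 + 14000   ≤⟨ +-monoʳ-≤ (n * 15 * 1000) (≤-trans (≤ᵇ⇒≤ 14000 20000 tt) (≤-trans n-large (m≤m*n n 22))) ⟩
  n * 15 * 1000 + n * 22  ≡⟨ cong (_+ n * 22) (*-assoc n 15 1000) ⟩
  n * 15000 + n * 22      ≡⟨ *-distribˡ-+ n 15000 22 ⟨
  n * 15022               ≡⟨ *-assoc n 1073 14 ⟨
  n * 1073 * 14           ≤⟨ *-monoˡ-≤ 14 scaled ⟩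
  (m + 1) * 1000 * 14     ≡⟨ *-assoc (m + 1) 1000 14 ⟩
  (m + 1) * 14000         ≡⟨ *-distribʳ-+ 14000 m 1 ⟩
  m * 14000 + 14000       ≡⟨ cong (_+ 14000) (*-assoc m 14 1000) ⟨
  m * 14 * 1000 + 14000   ∎))
  where
  open ≤-Reasoning
  m = mOf a b n
  swapʳ : ∀ x y z → x * y * z ≡ x * z * y
  swapʳ = solve-∀
  scaled : n * 1073 ≤ (m + 1) * 1000
  scaled = *-cancelʳ-≤ (n * 1073) ((m + 1) * 1000) (suc b) (begin
    n * 1073 * suc b             ≡⟨ *-assoc n 1073 (suc b) ⟩
    n * (1073 * suc b)           ≤⟨ *-monoʳ-≤ n ratio ⟩
    n * (1000 * a)               ≡⟨ cong (n *_) (*-comm 1000 a) ⟩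
    n * (a * 1000)               ≡⟨ *-assoc n a 1000 ⟨
    n * a * 1000                 ≡⟨ cong (_* 1000) (*-comm n a) ⟩
    a * n * 1000                 ≤⟨ *-monoˡ-≤ 1000 quotient ⟩
    (m + 1) * suc b * 1000       ≡⟨ swapʳ (m + 1) (suc b) 1000 ⟩
    (m + 1) * 1000 * suc b       ∎)
    where
    quotient : a * n ≤ (m + 1) * suc b
    quotient = begin
      a * n                             ≡⟨ m≡m%n+[m/n]*n (a * n) (suc b) ⟩
      (a * n) % suc b + m * suc b       ≤⟨ +-monoˡ-≤ (m * suc b) (<⇒≤ (m%n<n (a * n) (suc b))) ⟩
      suc b + m * suc b                 ≡⟨ cong (_* suc b) (+-comm m 1) ⟨
      (m + 1) * suc b                   ∎

-- The separator has k + 1 vertices: one half of the allowance pays for k, the other for the extra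
-- 1. Hence 20000 in β is twice the 10000 in `Good`.
halve-threshold : ∀ {s t} k n → t ≡ s * 2 → t * k ≤ 1 * n → t ≤ n → suc k * s ≤ n
halve-threshold {s} {t} k n refl tk≤n t≤n = *-cancelʳ-≤ (suc k * s) n 2 (begin
  suc k * s * 2            ≡⟨ distribute k s ⟩
  s * 2 + s * 2 * k        ≤⟨ +-mono-≤ t≤n tk≤n ⟩
  n + 1 * n                ≡⟨ *-comm 2 n ⟩
  n * 2                    ∎)
  where
  open ≤-Reasoning
  distribute : ∀ k s → suc k * s * 2 ≡ s * 2 + s * 2 * k
  distribute = solve-∀

combine : ∀ {A : Set} {x} c (xs ys : List A) → c * 2 * length xs ≤ x → c * 2 * length ys ≤ x →
  c * length (xs ++ ys) ≤ x
combine {x = x} c xs ys p q = *-cancelˡ-≤ 2 (begin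
  2 * (c * length (xs ++ ys))                    ≡⟨ cong (λ l → 2 * (c * l)) (length-++ xs) ⟩
  2 * (c * (length xs + length ys))              ≡⟨ distribute c (length xs) (length ys) ⟩
  c * 2 * length xs + c * 2 * length ys          ≤⟨ +-mono-≤ p q ⟩
  x + x                                          ≡⟨ cong (x +_) (+-identityʳ x) ⟨
  2 * x                                          ∎)
  where
  open ≤-Reasoning
  distribute : ∀ c l l′ → 2 * (c * (l + l′)) ≡ c * 2 * l + c * 2 * l′
  distribute = solve-∀

Rare-++ : ∀ F F′ → Rare F → Rare F′ → Rare (λ n m → F n m ++ F′ n m)
Rare-++ F F′ rare rare′ D with rare (D * 2) | rare′ (D * 2)
... | N , few | N′ , few′ = N + N′ , λ n m N+N′≤n edges → combine D (F n m) (F′ n m)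
  (few n m (m+n≤o⇒m≤o N N+N′≤n) edges) (few′ n m (m+n≤o⇒n≤o N N+N′≤n) edges)

lowTreewidthGraphs : ∀ n → ℕ → List (Graph n)
lowTreewidthGraphs n m = Bipartite.labelledGraphs n m ++ Tripartite.labelledGraphs n m

∈-lowTreewidthGraphs : ∀ {n m} (G : Graph n) → IsGnm n m G → TwAtMostRat G 1 20000 → 20000 ≤ n →
  G ∈ lowTreewidthGraphs n m
∈-lowTreewidthGraphs {n} {m} G gnm (k , tw , k-small) n-large =
  [ (λ ℓ → ∈-++⁺ˡ (Bipartite.∈-labelledGraphs m G gnm ℓ)) ,
    (λ ℓ → ∈-++⁺ʳ (Bipartite.labelledGraphs n m) (Tripartite.∈-labelledGraphs m G gnm ℓ)) ]′
  (goodLabelling G tw (halve-threshold {10000} {20000} k n refl k-small n-large))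

rarity⇒theorem : ∀ a b → 1073 * suc b ≤ 1000 * a → Rare lowTreewidthGraphs →
  (d : ℕ) → Σ ℕ λ N₀ → (n : ℕ) → N₀ ≤ n → Σ (List (Graph n)) λ L →
  ((G : Graph n) → IsGnm n (mOf a b n) G → TwAtMostRat G 1 20000 → G ∈ L) ×
  (suc d * length L ≤ (n C 2) C (mOf a b n))
rarity⇒theorem a b ratio rare d with rare (suc d)
... | N , few = N + 20000 , λ n N₀≤n →
  let n-large = m+n≤o⇒n≤o N N₀≤n in
  lowTreewidthGraphs n (mOf a b n) ,
  (λ G gnm tw → ∈-lowTreewidthGraphs G gnm tw n-large) ,
  few n (mOf a b n) (m+n≤o⇒m≤o N N₀≤n) (enough-edges a b n ratio n-large)

theorem1 : (a b : ℕ) → 1073 * suc b ≤ 1000 * a →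
    Σ ℕ λ p → Σ ℕ λ q → 0 < p × 0 < q ×
    ((d : ℕ) → Σ ℕ λ N₀ → (n : ℕ) → N₀ ≤ n →
    Σ (List (Graph n)) λ L →
    ((G : Graph n) → IsGnm n (mOf a b n) G → TwAtMostRat G p q → G ∈ L) ×
    (suc d * length L ≤ (n C 2) C (mOf a b n)))
theorem1 a b ratio = 1 , 20000 , s≤s z≤n , s≤s z≤n ,
  rarity⇒theorem a b ratio (Rare-++ Bipartite.labelledGraphs Tripartite.labelledGraphs rare₂ rare₃)
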